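{- There is an absolute constant $c>0$ such that for every integer $d\ge2$ and every $\varepsilon>0$, any $\varepsilon$-DP implicit representation scheme under the permutation representation for $d$-Hitting Set has approximation ratio at least $1+c\,e^{ -\varepsilon}$; that is, if such a scheme is an $\alpha$-approximation algorithm then $\alpha\ge1+c\,e^{ -\varepsilon}$.
   Context: $d$-Hitting Set: given a hypergraph $G=(V,E)$ in which each hyperedge has size at most $d$, find a minimum-size $S\subseteq V$ with $S\cap e\ne\emptyset$ for all $e\in E$; $\mathrm{opt}(G)$ is the optimum. Neighbors: two hypergraphs $G=(V,E)$, $G'=(V,E')$ on the same vertex set are neighbors if $|E\triangle E'|\le1$. A randomized algorithm $\mathcal{M}$ is $\varepsilon$-DP if for all neighboring $G\sim G'$ and all sets $\mathcal{S}$ of outcomes, $\Pr[\mathcal{M}(G)\in\mathcal{S}]\le e^{\varepsilon}\Pr[\mathcal{M}(G')\in\mathcal{S}]$. Scheme under the permutation representation: the encoder $\mathcal{E}(G;k)$ is a randomized algorithm, $\varepsilon$-DP for each fixed parameter $k$ and with arbitrary running time, which outputs a permutation (total order) $\pi$ of $V$. The decoder is fixed: $\mathcal{D}(G,\pi)$ outputs $S_\pi(E)=\{\min_\pi(e)\mid e\in E\}$, where $\min_\pi(e)$ is the element of $e$ that is earliest in $\pi$. Approximation: the scheme is an $\alpha$-approximation algorithm ($\alpha\ge1$) if for every input $G$ and every $k\ge\mathrm{opt}(G)$, $\mathbb{E}_{\pi\sim\mathcal{E}(G;k)}[|S_\pi(E)|]\le\alpha k$. -}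

module Defs where

open import Algebra.Bundles using (CommutativeRing)
open import Data.Bool.Base using (Bool; T; if_then_else_; _xor_)
open import Data.Fin.Base as Fin using (Fin)
import Data.Fin.Properties as Fin
open import Data.Fin.Permutation using (Permutation′; _⟨$⟩ʳ_; _≈_)
open import Data.Fin.Subset using (Subset; inside; outside; _∈_; _∩_; Nonempty) renaming (∣_∣ to size)
open import Data.Fin.Subset.Properties using (_∈?_; nonempty?)
open import Data.Integer.Base as ℤ using (+_)
import Data.Integer.Properties as ℤ
open import Data.Integer.Solver using () renaming (module +-*-Solver to ℤS)
open import Data.List.Base using (List; []; _∷_; _++_; map; filter; filterᵇ; foldr; length)
open import Data.List.Extrema.Nat using (min)
open import Data.List.Relation.Unary.All using (All; all?)
open import Data.List.Relation.Unary.Any using (Any; any?)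
open import Data.Nat.Base as ℕ using (ℕ; zero; suc)
import Data.Nat.Properties as ℕ
open import Data.Product.Base using (∃; _,_; _×_)
open import Data.Rational.Base as ℚ using (ℚ; 0ℚ; 1ℚ; ½; _+_; _*_; _-_; -_; _/_; 1/_; ∣_∣; _≤_; _<_; mkℚ; nonNegative; positive)
open import Data.Rational.Properties
open import Data.Rational.Solver using () renaming (module +-*-Solver to S)
import Data.Rational.Unnormalised.Base as ℚᵘ
import Data.Rational.Unnormalised.Properties as ℚᵘ
open import Data.Sum.Base using (inj₁; inj₂)
open import Data.Vec.Base as Vec using ([]; _∷_)
open import Relation.Binary.Core using (_Preserves_⟶_)
open import Relation.Binary.PropositionalEquality
open import Relation.Nullary.Decidable using (Dec; does; _×-dec_; _→-dec_)
open import Relation.Unary using (Decidable)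
open CommutativeRing +-*-commutativeRing using (commutativeSemiring; semiring)
open import Algebra.Properties.Semiring.Exp semiring using (_^_; ^-assocʳ)
open import Algebra.Properties.CommutativeSemiring.Exp commutativeSemiring using (^-distrib-*)

ι : ℕ → ℚ
ι n = + n / 1

u : ℕ → ℚ
u n = + 1 / suc n

compound : ℕ → ℚ → ℚ
compound n p = (1ℚ + p * u n) ^ suc n

module RationalLemmas where
  open ≤-Reasoning

  ι-suc : ∀ n → ι (suc n) ≡ 1ℚ + ι n
  ι-suc n = toℚᵘ-injective (ℚᵘ.≃-trans (toℚᵘ-fromℚᵘ (ℚᵘ.mkℚᵘ (+ suc n) 0))
    (ℚᵘ.≃-sym (ℚᵘ.≃-trans (toℚᵘ-homo-+ 1ℚ (ι n))
      (ℚᵘ.≃-trans (ℚᵘ.+-congʳ ℚᵘ.1ℚᵘ (toℚᵘ-fromℚᵘ (ℚᵘ.mkℚᵘ (+ n) 0)))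
        (ℚᵘ.*≡* (cong (ℤ._* + 1) (cong (λ z → + 1 ℤ.+ z) (ℤ.*-identityʳ (+ n)))))))))

  ι*u : ∀ n → ι (suc n) * u n ≡ 1ℚ
  ι*u n = toℚᵘ-injective (ℚᵘ.≃-trans (toℚᵘ-homo-* (ι (suc n)) (u n))
    (ℚᵘ.≃-trans (ℚᵘ.*-cong (toℚᵘ-fromℚᵘ (ℚᵘ.mkℚᵘ (+ suc n) 0)) (toℚᵘ-fromℚᵘ (ℚᵘ.mkℚᵘ (+ 1) n)))
      (ℚᵘ.*≡* (ℤS.solve 1 (λ x → (x ℤS.:* ℤS.con (+ 1)) ℤS.:* ℤS.con (+ 1) ℤS.:= ℤS.con (+ 1) ℤS.:* (ℤS.con (+ 1) ℤS.:* x)) refl (+ suc n)))))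

  0≤ι : ∀ n → 0ℚ ≤ ι n
  0≤ι n = nonNegative⁻¹ (ι n) ⦃ normalize-nonNeg n 1 ⦄

  0≤u : ∀ n → 0ℚ ≤ u n
  0≤u n = nonNegative⁻¹ (u n) ⦃ normalize-nonNeg 1 (suc n) ⦄

  ι-+ : ∀ m n → ι (m ℕ.+ n) ≡ ι m + ι n
  ι-+ zero    n = sym (+-identityˡ (ι n))
  ι-+ (suc m) n = trans (ι-suc (m ℕ.+ n)) (trans (cong (_+_ 1ℚ) (ι-+ m n))
    (trans (sym (+-assoc 1ℚ (ι m) (ι n))) (cong (_+ ι n) (sym (ι-suc m)))))

  ι-* : ∀ m n → ι (m ℕ.* n) ≡ ι m * ι n
  ι-* zero    n = sym (*-zeroˡ (ι n))
  ι-* (suc m) n = trans (ι-+ n (m ℕ.* n)) (trans (cong (_+_ (ι n)) (ι-* m n))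
    (trans (S.solve 2 (λ a b → b S.:+ a S.:* b S.:= (S.con 1ℚ S.:+ a) S.:* b) refl (ι m) (ι n))
      (cong (_* ι n) (sym (ι-suc m)))))

  0≤1 : 0ℚ ≤ 1ℚ
  0≤1 = nonNegative⁻¹ 1ℚ

  +-nonNeg : ∀ {p q} → 0ℚ ≤ p → 0ℚ ≤ q → 0ℚ ≤ p + q
  +-nonNeg 0≤p 0≤q = +-mono-≤ 0≤p 0≤q

  *-mono : ∀ {p q r s} → 0ℚ ≤ p → p ≤ q → 0ℚ ≤ r → r ≤ s → p * r ≤ q * s
  *-mono {p} {q} {r} {s} 0≤p p≤q 0≤r r≤s = ≤-trans
    (*-monoʳ-≤-nonNeg r ⦃ nonNegative 0≤r ⦄ p≤q)
    (*-monoˡ-≤-nonNeg q ⦃ nonNegative (≤-trans 0≤p p≤q) ⦄ r≤s)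

  *-nonNeg : ∀ {p q} → 0ℚ ≤ p → 0ℚ ≤ q → 0ℚ ≤ p * q
  *-nonNeg {p} {q} 0≤p 0≤q = *-mono ≤-refl 0≤p ≤-refl 0≤q

  *-monoˡ : ∀ {r p q} → 0ℚ ≤ r → p ≤ q → r * p ≤ r * q
  *-monoˡ {r} 0≤r = *-monoˡ-≤-nonNeg r ⦃ nonNegative 0≤r ⦄

  *-monoʳ : ∀ {r p q} → 0ℚ ≤ r → p ≤ q → p * r ≤ q * r
  *-monoʳ {r} 0≤r = *-monoʳ-≤-nonNeg r ⦃ nonNegative 0≤r ⦄

  p≤p+q : ∀ {p q} → 0ℚ ≤ q → p ≤ p + q
  p≤p+q {p} {q} 0≤q = subst (_≤ p + q) (+-identityʳ p) (+-monoʳ-≤ p 0≤q)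

  p≤q+p : ∀ {p q} → 0ℚ ≤ q → p ≤ q + p
  p≤q+p {p} {q} 0≤q = subst (p ≤_) (+-comm p q) (p≤p+q 0≤q)

  0≤p*p : ∀ p → 0ℚ ≤ p * p
  0≤p*p p with ≤-total 0ℚ p
  ... | inj₁ 0≤p = *-nonNeg 0≤p 0≤p
  ... | inj₂ p≤0 = subst (0ℚ ≤_) (S.solve 1 (λ a → (S.:- a) S.:* (S.:- a) S.:= a S.:* a) refl p)
                     (*-nonNeg (neg-antimono-≤ p≤0) (neg-antimono-≤ p≤0))

  ∣p∣*∣p∣ : ∀ p → ∣ p ∣ * ∣ p ∣ ≡ p * p
  ∣p∣*∣p∣ p = trans (sym (∣p*q∣≡∣p∣*∣q∣ p p)) (0≤p⇒∣p∣≡p (0≤p*p p))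

  ^-nonNeg : ∀ {p} k → 0ℚ ≤ p → 0ℚ ≤ p ^ k
  ^-nonNeg zero    0≤p = 0≤1
  ^-nonNeg (suc k) 0≤p = *-nonNeg 0≤p (^-nonNeg k 0≤p)

  ^-mono : ∀ {p q} k → 0ℚ ≤ p → p ≤ q → p ^ k ≤ q ^ k
  ^-mono zero    0≤p p≤q = ≤-refl
  ^-mono (suc k) 0≤p p≤q = *-mono 0≤p p≤q (^-nonNeg k 0≤p) (^-mono k 0≤p p≤q)

  1^ : ∀ k → 1ℚ ^ k ≡ 1ℚ
  1^ zero    = refl
  1^ (suc k) = trans (*-identityˡ (1ℚ ^ k)) (1^ k)

  1≤^ : ∀ {p} k → 1ℚ ≤ p → 1ℚ ≤ p ^ k
  1≤^ {p} k 1≤p = subst (_≤ p ^ k) (1^ k) (^-mono k 0≤1 1≤p)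

  ^≤1 : ∀ {p} k → 0ℚ ≤ p → p ≤ 1ℚ → p ^ k ≤ 1ℚ
  ^≤1 {p} k 0≤p p≤1 = subst (p ^ k ≤_) (1^ k) (^-mono k 0≤p p≤1)

  ∣^∣ : ∀ p k → ∣ p ^ k ∣ ≡ ∣ p ∣ ^ k
  ∣^∣ p zero    = refl
  ∣^∣ p (suc k) = trans (∣p*q∣≡∣p∣*∣q∣ p (p ^ k)) (cong (∣ p ∣ *_) (∣^∣ p k))

  ∣^∣≤ : ∀ {p M} k → ∣ p ∣ ≤ M → ∣ p ^ k ∣ ≤ M ^ k
  ∣^∣≤ {p} {M} k ∣p∣≤M = subst (_≤ M ^ k) (sym (∣^∣ p k)) (^-mono k (0≤∣p∣ p) ∣p∣≤M)

  bernoulli : ∀ k t → 0ℚ ≤ 1ℚ + t → 1ℚ + ι k * t ≤ (1ℚ + t) ^ k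
  bernoulli zero    t 0≤1+t = ≤-reflexive (S.solve 1 (λ t → S.con 1ℚ S.:+ S.con 0ℚ S.:* t S.:= S.con 1ℚ) refl t)
  bernoulli (suc k) t 0≤1+t = begin
    1ℚ + ι (suc k) * t                     ≡⟨ cong (λ z → 1ℚ + z * t) (ι-suc k) ⟩
    1ℚ + (1ℚ + ι k) * t                    ≤⟨ p≤p+q (*-nonNeg (0≤ι k) (0≤p*p t)) ⟩
    1ℚ + (1ℚ + ι k) * t + ι k * (t * t)    ≡⟨ S.solve 2 (λ c t → S.con 1ℚ S.:+ (S.con 1ℚ S.:+ c) S.:* t S.:+ c S.:* (t S.:* t)
                                                 S.:= (S.con 1ℚ S.:+ t) S.:* (S.con 1ℚ S.:+ c S.:* t)) refl (ι k) t ⟩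
    (1ℚ + t) * (1ℚ + ι k * t)              ≤⟨ *-monoˡ 0≤1+t (bernoulli k t 0≤1+t) ⟩
    (1ℚ + t) ^ suc k                       ∎

  u≤1 : ∀ n → u n ≤ 1ℚ
  u≤1 n = begin
    u n                ≤⟨ p≤p+q (*-nonNeg (0≤ι n) (0≤u n)) ⟩
    u n + ι n * u n    ≡⟨ S.solve 2 (λ c v → v S.:+ c S.:* v S.:= (S.con 1ℚ S.:+ c) S.:* v) refl (ι n) (u n) ⟩
    (1ℚ + ι n) * u n   ≡⟨ cong (_* u n) (ι-suc n) ⟨
    ι (suc n) * u n    ≡⟨ ι*u n ⟩
    1ℚ                 ∎

  2ℚ : ℚ
  2ℚ = + 2 / 1

  half-growth : ∀ n → (1ℚ + ½ * u n) ^ suc n ≤ 2ℚ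
  half-growth n = *-cancelʳ-≤-pos ½ (begin
    (1ℚ + t) ^ N * ½                  ≡⟨ cong ((1ℚ + t) ^ N *_) ½≡ ⟩
    (1ℚ + t) ^ N * (1ℚ + ι N * - t)   ≤⟨ *-monoˡ (^-nonNeg N (+-nonNeg 0≤1 0≤t)) (bernoulli N (- t) 0≤1-t) ⟩
    (1ℚ + t) ^ N * (1ℚ + - t) ^ N     ≡⟨ ^-distrib-* (1ℚ + t) (1ℚ + - t) N ⟨
    ((1ℚ + t) * (1ℚ + - t)) ^ N       ≤⟨ ^≤1 N (*-nonNeg (+-nonNeg 0≤1 0≤t) 0≤1-t) sq ⟩
    1ℚ                                ∎)
    where
    N = suc n
    t = ½ * u n
    0≤t : 0ℚ ≤ t
    0≤t = *-nonNeg (nonNegative⁻¹ ½) (0≤u n)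
    t≤1 : t ≤ 1ℚ
    t≤1 = ≤-trans (*-monoˡ (nonNegative⁻¹ ½) (u≤1 n)) (≤ᵇ⇒≤ _)
    0≤1-t : 0ℚ ≤ 1ℚ + - t
    0≤1-t = subst (_≤ 1ℚ + - t) (+-inverseʳ t) (+-monoˡ-≤ (- t) t≤1)
    ½≡ : ½ ≡ 1ℚ + ι N * - t
    ½≡ = sym (trans (S.solve 2 (λ c v → S.con 1ℚ S.:+ c S.:* (S.:- (S.con ½ S.:* v)) S.:= S.con 1ℚ S.:+ S.:- (S.con ½ S.:* (c S.:* v))) refl (ι N) (u n))
               (cong (λ z → 1ℚ + - (½ * z)) (ι*u n)))
    sq : (1ℚ + t) * (1ℚ + - t) ≤ 1ℚ
    sq = begin
      (1ℚ + t) * (1ℚ + - t)          ≤⟨ p≤p+q (0≤p*p t) ⟩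
      (1ℚ + t) * (1ℚ + - t) + t * t  ≡⟨ S.solve 1 (λ t → (S.con 1ℚ S.:+ t) S.:* (S.con 1ℚ S.:+ S.:- t) S.:+ t S.:* t S.:= S.con 1ℚ) refl t ⟩
      1ℚ                             ∎

  cap : ℕ → ℚ
  cap B = 2ℚ ^ (B ℕ.+ B)

  0≤cap : ∀ B → 0ℚ ≤ cap B
  0≤cap B = ^-nonNeg (B ℕ.+ B) (nonNegative⁻¹ 2ℚ)

  ^-swap : ∀ p m n → (p ^ m) ^ n ≡ (p ^ n) ^ m
  ^-swap p m n = trans (^-assocʳ p m n) (trans (cong (p ^_) (ℕ.*-comm m n)) (sym (^-assocʳ p n m)))

  growth : ∀ B n → (1ℚ + ι B * u n) ^ suc n ≤ cap B
  growth B n = begin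
    (1ℚ + ι B * u n) ^ suc n          ≡⟨ cong (λ z → (1ℚ + z) ^ suc n) eq ⟩
    (1ℚ + ι (B ℕ.+ B) * t) ^ suc n    ≤⟨ ^-mono (suc n) (+-nonNeg 0≤1 (*-nonNeg (0≤ι (B ℕ.+ B)) 0≤t)) (bernoulli (B ℕ.+ B) t (+-nonNeg 0≤1 0≤t)) ⟩
    ((1ℚ + t) ^ (B ℕ.+ B)) ^ suc n    ≡⟨ ^-swap (1ℚ + t) (B ℕ.+ B) (suc n) ⟩
    ((1ℚ + t) ^ suc n) ^ (B ℕ.+ B)    ≤⟨ ^-mono (B ℕ.+ B) (^-nonNeg (suc n) (+-nonNeg 0≤1 0≤t)) (half-growth n) ⟩
    cap B                             ∎
    where
    t = ½ * u n
    0≤t : 0ℚ ≤ t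
    0≤t = *-nonNeg (nonNegative⁻¹ ½) (0≤u n)
    eq : ι B * u n ≡ ι (B ℕ.+ B) * t
    eq = trans (S.solve 2 (λ b v → b S.:* v S.:= (b S.:+ b) S.:* (S.con ½ S.:* v)) refl (ι B) (u n))
           (cong (_* t) (sym (ι-+ B B)))

  lipschitz : ∀ {a b M} k → 1ℚ ≤ M → ∣ a ∣ ≤ M → ∣ b ∣ ≤ M → ∣ a ^ k - b ^ k ∣ ≤ ι k * (M ^ k * ∣ a - b ∣)
  lipschitz {a} {b} {M} zero    1≤M a≤M b≤M = ≤-reflexive (sym (*-zeroˡ (1ℚ * ∣ a - b ∣)))
  lipschitz {a} {b} {M} (suc k) 1≤M a≤M b≤M = begin
    ∣ a * a ^ k - b * b ^ k ∣
      ≡⟨ cong ∣_∣ (S.solve 4 (λ a p b q → a S.:* p S.:- b S.:* q S.:= a S.:* (p S.:- q) S.:+ q S.:* (a S.:- b)) refl a (a ^ k) b (b ^ k)) ⟩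
    ∣ a * (a ^ k - b ^ k) + b ^ k * (a - b) ∣
      ≤⟨ ∣p+q∣≤∣p∣+∣q∣ (a * (a ^ k - b ^ k)) (b ^ k * (a - b)) ⟩
    ∣ a * (a ^ k - b ^ k) ∣ + ∣ b ^ k * (a - b) ∣
      ≡⟨ cong₂ _+_ (∣p*q∣≡∣p∣*∣q∣ a (a ^ k - b ^ k)) (∣p*q∣≡∣p∣*∣q∣ (b ^ k) (a - b)) ⟩
    ∣ a ∣ * ∣ a ^ k - b ^ k ∣ + ∣ b ^ k ∣ * d
      ≤⟨ +-mono-≤ (*-mono (0≤∣p∣ a) a≤M (0≤∣p∣ (a ^ k - b ^ k)) (lipschitz k 1≤M a≤M b≤M))
                  (*-monoʳ (0≤∣p∣ (a - b)) (≤-trans (∣^∣≤ k b≤M) M^k≤)) ⟩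
    M * (ι k * (M ^ k * d)) + M ^ suc k * d
      ≡⟨ S.solve 4 (λ M c P d → M S.:* (c S.:* (P S.:* d)) S.:+ M S.:* P S.:* d S.:= (S.con 1ℚ S.:+ c) S.:* (M S.:* P S.:* d)) refl M (ι k) (M ^ k) d ⟩
    (1ℚ + ι k) * (M ^ suc k * d)
      ≡⟨ cong (_* (M ^ suc k * d)) (ι-suc k) ⟨
    ι (suc k) * (M ^ suc k * d) ∎
    where
    d = ∣ a - b ∣
    0≤M = ≤-trans 0≤1 1≤M
    M^k≤ : M ^ k ≤ M ^ suc k
    M^k≤ = subst (_≤ M ^ suc k) (*-identityˡ (M ^ k)) (*-monoʳ (^-nonNeg k 0≤M) 1≤M)

  ∣1+p∣≤ : ∀ p → ∣ 1ℚ + p ∣ ≤ 1ℚ + ∣ p ∣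
  ∣1+p∣≤ p = ∣p+q∣≤∣p∣+∣q∣ 1ℚ p

  linearise : ∀ m t → ∣ (1ℚ + t) ^ m - (1ℚ + ι m * t) ∣ ≤ (ι m * ∣ t ∣) * (ι m * ∣ t ∣) * (1ℚ + ∣ t ∣) ^ m
  linearise zero    t = ≤-reflexive (trans
    (cong ∣_∣ (S.solve 1 (λ t → S.con 1ℚ S.:- (S.con 1ℚ S.:+ S.con 0ℚ S.:* t) S.:= S.con 0ℚ) refl t))
    (S.solve 1 (λ s → S.con 0ℚ S.:= (S.con 0ℚ S.:* s) S.:* (S.con 0ℚ S.:* s) S.:* S.con 1ℚ) refl ∣ t ∣))
  linearise (suc m) t = begin
    ∣ (1ℚ + t) * P - (1ℚ + ι (suc m) * t) ∣
      ≡⟨ cong ∣_∣ (trans (cong (λ z → (1ℚ + t) * P - (1ℚ + z * t)) (ι-suc m))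
           (S.solve 3 (λ t P c → (S.con 1ℚ S.:+ t) S.:* P S.:- (S.con 1ℚ S.:+ (S.con 1ℚ S.:+ c) S.:* t)
              S.:= (S.con 1ℚ S.:+ t) S.:* (P S.:- (S.con 1ℚ S.:+ c S.:* t)) S.:+ c S.:* (t S.:* t)) refl t P c)) ⟩
    ∣ (1ℚ + t) * D + c * (t * t) ∣
      ≤⟨ ∣p+q∣≤∣p∣+∣q∣ ((1ℚ + t) * D) (c * (t * t)) ⟩
    ∣ (1ℚ + t) * D ∣ + ∣ c * (t * t) ∣
      ≡⟨ cong₂ _+_ (∣p*q∣≡∣p∣*∣q∣ (1ℚ + t) D) (trans (0≤p⇒∣p∣≡p (*-nonNeg (0≤ι m) (0≤p*p t))) (cong (c *_) (sym (∣p∣*∣p∣ t)))) ⟩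
    ∣ 1ℚ + t ∣ * ∣ D ∣ + c * (s * s)
      ≤⟨ +-monoˡ-≤ (c * (s * s)) (*-mono (0≤∣p∣ (1ℚ + t)) (∣1+p∣≤ t) (0≤∣p∣ D) (linearise m t)) ⟩
    (1ℚ + s) * ((c * s) * (c * s) * Q) + c * (s * s)
      ≤⟨ +-monoʳ-≤ ((1ℚ + s) * ((c * s) * (c * s) * Q)) (subst (_≤ c * (s * s) * R) (*-identityʳ (c * (s * s)))
           (*-monoˡ (*-nonNeg (0≤ι m) (*-nonNeg 0≤s 0≤s)) 1≤R)) ⟩
    (1ℚ + s) * ((c * s) * (c * s) * Q) + c * (s * s) * R
      ≤⟨ p≤p+q (*-nonNeg (*-nonNeg (+-nonNeg 0≤1 (0≤ι m)) (*-nonNeg 0≤s 0≤s)) (≤-trans 0≤1 1≤R)) ⟩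
    (1ℚ + s) * ((c * s) * (c * s) * Q) + c * (s * s) * R + (1ℚ + c) * (s * s) * R
      ≡⟨ S.solve 3 (λ s c Q → (S.con 1ℚ S.:+ s) S.:* ((c S.:* s) S.:* (c S.:* s) S.:* Q) S.:+ c S.:* (s S.:* s) S.:* ((S.con 1ℚ S.:+ s) S.:* Q)
                  S.:+ (S.con 1ℚ S.:+ c) S.:* (s S.:* s) S.:* ((S.con 1ℚ S.:+ s) S.:* Q)
             S.:= ((S.con 1ℚ S.:+ c) S.:* s) S.:* ((S.con 1ℚ S.:+ c) S.:* s) S.:* ((S.con 1ℚ S.:+ s) S.:* Q)) refl s c Q ⟩
    ((1ℚ + c) * s) * ((1ℚ + c) * s) * R
      ≡⟨ cong (λ z → (z * s) * (z * s) * R) (ι-suc m) ⟨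
    (ι (suc m) * s) * (ι (suc m) * s) * R ∎
    where
    c = ι m
    s = ∣ t ∣
    P = (1ℚ + t) ^ m
    Q = (1ℚ + s) ^ m
    R = (1ℚ + s) ^ suc m
    D = P - (1ℚ + c * t)
    0≤s = 0≤∣p∣ t
    1≤R : 1ℚ ≤ R
    1≤R = 1≤^ (suc m) (p≤p+q 0≤s)

  ∣-∣-sym : ∀ p q → ∣ p - q ∣ ≡ ∣ q - p ∣
  ∣-∣-sym p q = trans (cong ∣_∣ (S.solve 2 (λ a b → a S.:- b S.:= S.:- (b S.:- a)) refl p q)) (∣-p∣≡∣p∣ (q - p))

  ∣-∣-triangle : ∀ p q r → ∣ p - r ∣ ≤ ∣ p - q ∣ + ∣ q - r ∣
  ∣-∣-triangle p q r = subst (λ z → ∣ z ∣ ≤ ∣ p - q ∣ + ∣ q - r ∣)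
    (S.solve 3 (λ a b c → (a S.:- b) S.:+ (b S.:- c) S.:= a S.:- c) refl p q r) (∣p+q∣≤∣p∣+∣q∣ (p - q) (q - r))

  base : ℕ → ℕ → ℚ
  base B n = 1ℚ + ι B * u n

  1≤base : ∀ B n → 1ℚ ≤ base B n
  1≤base B n = p≤p+q (*-nonNeg (0≤ι B) (0≤u n))

  ∣1+pu∣≤ : ∀ {p} B n → ∣ p ∣ ≤ ι B → ∣ 1ℚ + p * u n ∣ ≤ base B n
  ∣1+pu∣≤ {p} B n p≤B = ≤-trans (∣1+p∣≤ (p * u n)) (+-monoʳ-≤ 1ℚ (begin
    ∣ p * u n ∣      ≡⟨ ∣p*q∣≡∣p∣*∣q∣ p (u n) ⟩
    ∣ p ∣ * ∣ u n ∣  ≡⟨ cong (∣ p ∣ *_) (0≤p⇒∣p∣≡p (0≤u n)) ⟩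
    ∣ p ∣ * u n      ≤⟨ *-monoʳ (0≤u n) p≤B ⟩
    ι B * u n        ∎))

  compound-lipschitz : ∀ {p q} B n → ∣ p ∣ ≤ ι B → ∣ q ∣ ≤ ι B →
                       ∣ compound n p - compound n q ∣ ≤ cap B * ∣ p - q ∣
  compound-lipschitz {p} {q} B n p≤B q≤B = begin
    ∣ compound n p - compound n q ∣
      ≤⟨ lipschitz (suc n) (1≤base B n) (∣1+pu∣≤ B n p≤B) (∣1+pu∣≤ B n q≤B) ⟩
    ι (suc n) * (base B n ^ suc n * ∣ (1ℚ + p * u n) - (1ℚ + q * u n) ∣)
      ≡⟨ cong (λ z → ι (suc n) * (base B n ^ suc n * z)) eq ⟩
    ι (suc n) * (base B n ^ suc n * (∣ p - q ∣ * u n))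
      ≡⟨ S.solve 4 (λ c v G d → c S.:* (G S.:* (d S.:* v)) S.:= (c S.:* v) S.:* (G S.:* d)) refl (ι (suc n)) (u n) (base B n ^ suc n) ∣ p - q ∣ ⟩
    ι (suc n) * u n * (base B n ^ suc n * ∣ p - q ∣)
      ≡⟨ trans (cong (_* (base B n ^ suc n * ∣ p - q ∣)) (ι*u n)) (*-identityˡ _) ⟩
    base B n ^ suc n * ∣ p - q ∣
      ≤⟨ *-monoʳ (0≤∣p∣ (p - q)) (growth B n) ⟩
    cap B * ∣ p - q ∣ ∎
    where
    eq : ∣ (1ℚ + p * u n) - (1ℚ + q * u n) ∣ ≡ ∣ p - q ∣ * u n
    eq = trans (cong ∣_∣ (S.solve 3 (λ p q v → (S.con 1ℚ S.:+ p S.:* v) S.:- (S.con 1ℚ S.:+ q S.:* v) S.:= (p S.:- q) S.:* v) refl p q (u n)))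
           (trans (∣p*q∣≡∣p∣*∣q∣ (p - q) (u n)) (cong (∣ p - q ∣ *_) (0≤p⇒∣p∣≡p (0≤u n))))

  const : ℕ → ℚ
  const B = cap B * cap B * (ι B * ι B)

  0≤const : ∀ B → 0ℚ ≤ const B
  0≤const B = *-nonNeg (*-nonNeg (0≤cap B) (0≤cap B)) (0≤p*p (ι B))

  common : ℕ → ℕ → ℕ
  common n m = m ℕ.+ n ℕ.* suc m

  common-sym : ∀ n m → common n m ≡ common m n
  common-sym n m = ℕ.suc-injective (ℕ.*-comm (suc n) (suc m))

  u-common : ∀ n m → ι (suc m) * u (common n m) ≡ u n
  u-common n m = begin-equality
    ι (suc m) * v                            ≡⟨ *-identityˡ (ι (suc m) * v) ⟨
    1ℚ * (ι (suc m) * v)                     ≡⟨ cong (_* (ι (suc m) * v)) (ι*u n) ⟨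
    ι (suc n) * u n * (ι (suc m) * v)        ≡⟨ S.solve 4 (λ a b c v → a S.:* b S.:* (c S.:* v) S.:= b S.:* ((a S.:* c) S.:* v)) refl (ι (suc n)) (u n) (ι (suc m)) v ⟩
    u n * (ι (suc n) * ι (suc m) * v)        ≡⟨ cong (λ z → u n * (z * v)) (ι-* (suc n) (suc m)) ⟨
    u n * (ι (suc n ℕ.* suc m) * v)          ≡⟨ cong (u n *_) (ι*u (common n m)) ⟩
    u n * 1ℚ                                 ≡⟨ *-identityʳ (u n) ⟩
    u n                                      ∎
    where v = u (common n m)

  refine : ∀ {p} B n m → ∣ p ∣ ≤ ι B → ∣ compound n p - compound (common n m) p ∣ ≤ const B * u n
  refine {p} B n m p≤B = begin
    ∣ compound n p - compound K p ∣
      ≡⟨ cong (λ z → ∣ D ^ suc n - z ∣) (trans (cong ((1ℚ + t) ^_) (ℕ.*-comm (suc n) (suc m))) (sym (^-assocʳ (1ℚ + t) (suc m) (suc n)))) ⟩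
    ∣ D ^ suc n - A ^ suc n ∣
      ≤⟨ lipschitz (suc n) 1≤M D≤M A≤M ⟩
    ι (suc n) * (M ^ suc n * ∣ D - A ∣)
      ≤⟨ *-monoˡ (0≤ι (suc n)) (*-mono (^-nonNeg (suc n) 0≤M) M^N≤cap (0≤∣p∣ (D - A)) D-A≤) ⟩
    ι (suc n) * (cap B * ((ι B * u n) * (ι B * u n) * cap B))
      ≡⟨ S.solve 4 (λ c v G b → c S.:* (G S.:* ((b S.:* v) S.:* (b S.:* v) S.:* G)) S.:= (c S.:* v) S.:* (G S.:* G S.:* (b S.:* b) S.:* v)) refl (ι (suc n)) (u n) (cap B) (ι B) ⟩
    ι (suc n) * u n * (const B * u n)
      ≡⟨ trans (cong (_* (const B * u n)) (ι*u n)) (*-identityˡ _) ⟩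
    const B * u n ∎
    where
    K = common n m
    t = p * u K
    D = 1ℚ + p * u n
    A = (1ℚ + t) ^ suc m
    M = base B K ^ suc m
    1≤M : 1ℚ ≤ M
    1≤M = 1≤^ (suc m) (1≤base B K)
    0≤M = ≤-trans 0≤1 1≤M
    D≡ : D ≡ 1ℚ + ι (suc m) * t
    D≡ = cong (_+_ 1ℚ) (trans (cong (p *_) (sym (u-common n m)))
           (S.solve 3 (λ p c v → p S.:* (c S.:* v) S.:= c S.:* (p S.:* v)) refl p (ι (suc m)) (u K)))
    baseD : base B n ≤ M
    baseD = subst (_≤ M) (cong (_+_ 1ℚ) (trans (S.solve 3 (λ c b v → c S.:* (b S.:* v) S.:= b S.:* (c S.:* v)) refl (ι (suc m)) (ι B) (u K)) (cong (ι B *_) (u-common n m))))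
              (bernoulli (suc m) (ι B * u K) (≤-trans 0≤1 (1≤base B K)))
    D≤M : ∣ D ∣ ≤ M
    D≤M = ≤-trans (∣1+pu∣≤ B n p≤B) baseD
    A≤M : ∣ A ∣ ≤ M
    A≤M = ∣^∣≤ (suc m) (∣1+pu∣≤ B K p≤B)
    M^N≤cap : M ^ suc n ≤ cap B
    M^N≤cap = subst (_≤ cap B) (sym (trans (^-assocʳ (base B K) (suc m) (suc n)) (cong (base B K ^_) (ℕ.*-comm (suc m) (suc n))))) (growth B K)
    M≤cap : M ≤ cap B
    M≤cap = ≤-trans (subst (_≤ M ^ suc n) (*-identityʳ M) (*-monoˡ 0≤M (1≤^ n 1≤M))) M^N≤cap
    ∣t∣≤ : ∣ t ∣ ≤ ι B * u K
    ∣t∣≤ = subst (_≤ ι B * u K) (sym (trans (∣p*q∣≡∣p∣*∣q∣ p (u K)) (cong (∣ p ∣ *_) (0≤p⇒∣p∣≡p (0≤u K))))) (*-monoʳ (0≤u K) p≤B)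
    mt≤ : ι (suc m) * ∣ t ∣ ≤ ι B * u n
    mt≤ = ≤-trans (*-monoˡ (0≤ι (suc m)) ∣t∣≤) (≤-reflexive (trans
            (S.solve 3 (λ c b v → c S.:* (b S.:* v) S.:= b S.:* (c S.:* v)) refl (ι (suc m)) (ι B) (u K)) (cong (ι B *_) (u-common n m))))
    0≤mt = *-nonNeg (0≤ι (suc m)) (0≤∣p∣ t)
    D-A≤ : ∣ D - A ∣ ≤ (ι B * u n) * (ι B * u n) * cap B
    D-A≤ = begin
      ∣ D - A ∣                           ≡⟨ ∣-∣-sym D A ⟩
      ∣ A - D ∣                           ≡⟨ cong (λ z → ∣ A - z ∣) D≡ ⟩
      ∣ A - (1ℚ + ι (suc m) * t) ∣        ≤⟨ linearise (suc m) t ⟩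
      (ι (suc m) * ∣ t ∣) * (ι (suc m) * ∣ t ∣) * (1ℚ + ∣ t ∣) ^ suc m
        ≤⟨ *-mono (*-nonNeg 0≤mt 0≤mt) (*-mono 0≤mt mt≤ 0≤mt mt≤) (^-nonNeg (suc m) 0≤1+t)
             (≤-trans (^-mono (suc m) 0≤1+t (+-monoʳ-≤ 1ℚ ∣t∣≤)) M≤cap) ⟩
      (ι B * u n) * (ι B * u n) * cap B   ∎
      where 0≤1+t = +-nonNeg 0≤1 (0≤∣p∣ t)

  compound-cauchy : ∀ {p} B n m → ∣ p ∣ ≤ ι B → ∣ compound n p - compound m p ∣ ≤ const B * u n + const B * u m
  compound-cauchy {p} B n m p≤B = begin
    ∣ compound n p - compound m p ∣
      ≤⟨ ∣-∣-triangle (compound n p) (compound K p) (compound m p) ⟩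
    ∣ compound n p - compound K p ∣ + ∣ compound K p - compound m p ∣
      ≡⟨ cong (_+_ ∣ compound n p - compound K p ∣) (trans (∣-∣-sym (compound K p) (compound m p))
           (cong (λ k → ∣ compound m p - compound k p ∣) (common-sym n m))) ⟩
    ∣ compound n p - compound K p ∣ + ∣ compound m p - compound (common m n) p ∣
      ≤⟨ +-mono-≤ (refine B n m p≤B) (refine B m n p≤B) ⟩
    const B * u n + const B * u m ∎
    where K = common n m

  archimedean : ∀ p → ∃ λ k → p ≤ ι k
  archimedean p@(mkℚ n d-1 _) = ℤ.∣ n ∣ , toℚᵘ-cancel-≤ (ℚᵘ.≤-respʳ-≃
    (ℚᵘ.≃-sym (toℚᵘ-fromℚᵘ (ℚᵘ.mkℚᵘ (+ ℤ.∣ n ∣) 0)))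
    (ℚᵘ.*≤* (ℤ.≤-trans (ℤ.≤-reflexive (ℤ.*-identityʳ n)) (lemma n))))
    where
    lemma : ∀ i → i ℤ.≤ + ℤ.∣ i ∣ ℤ.* + suc d-1
    lemma (+ n)      = subst (+ n ℤ.≤_) (ℤ.pos-* n (suc d-1)) (ℤ.+≤+ (ℕ.m≤m*n n (suc d-1)))
    lemma (ℤ.-[1+ n ]) = ℤ.-≤+

  ι-mono : ∀ {m n} → m ℕ.≤ n → ι m ≤ ι n
  ι-mono {m} m≤n with k , refl ← ℕ.m≤n⇒∃[o]m+o≡n m≤n = subst (ι m ≤_) (sym (ι-+ m k)) (p≤p+q (0≤ι k))

  u-small : ∀ δ → 0ℚ < δ → ∃ λ N → ∀ n → N ℕ.≤ n → u n ≤ δ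
  u-small δ 0<δ with k , 1/δ≤k ← archimedean ((1/ δ) ⦃ pos⇒nonZero δ ⦃ positive 0<δ ⦄ ⦄) = k , λ n k≤n → begin
    u n                      ≡⟨ *-identityʳ (u n) ⟨
    u n * 1ℚ                 ≡⟨ cong (u n *_) (*-inverseˡ δ ⦃ pos⇒nonZero δ ⦃ positive 0<δ ⦄ ⦄) ⟨
    u n * ((1/ δ) ⦃ pos⇒nonZero δ ⦃ positive 0<δ ⦄ ⦄ * δ)
      ≤⟨ *-monoˡ (0≤u n) (*-monoʳ (<⇒≤ 0<δ) (≤-trans 1/δ≤k (ι-mono (ℕ.m≤n⇒m≤1+n k≤n)))) ⟩
    u n * (ι (suc n) * δ)    ≡⟨ S.solve 3 (λ v c d → v S.:* (c S.:* d) S.:= (c S.:* v) S.:* d) refl (u n) (ι (suc n)) δ ⟩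
    ι (suc n) * u n * δ      ≡⟨ trans (cong (_* δ) (ι*u n)) (*-identityˡ δ) ⟩
    δ                        ∎

open RationalLemmas

CloseFrom : (ℕ → ℚ) → ℚ → Set
CloseFrom x δ = ∃ λ N → ∀ m n → N ℕ.≤ m → N ℕ.≤ n → ∣ x m - x n ∣ ≤ δ

IsCauchy : (ℕ → ℚ) → Set
IsCauchy x = ∀ δ → 0ℚ < δ → CloseFrom x δ

record ℝ : Set where
  constructor mkℝ
  field
    seq    : ℕ → ℚ
    cauchy : IsCauchy seq

open ℝ public

Eventually : (ℕ → Set) → Set
Eventually P = ∃ λ N → ∀ n → N ℕ.≤ n → P n

infix 4 _≤ℝ_ _<ℝ_ _≈ℝ_

_≤ℝ_ _<ℝ_ _≈ℝ_ : ℝ → ℝ → Set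
x ≤ℝ y = ∀ δ → 0ℚ < δ → Eventually λ n → seq x n ≤ seq y n + δ
x <ℝ y = ∃ λ δ → 0ℚ < δ × Eventually λ n → seq x n + δ ≤ seq y n
x ≈ℝ y = ∀ δ → 0ℚ < δ → Eventually λ n → ∣ seq x n - seq y n ∣ ≤ δ

module CauchyLemmas where
  open ≤-Reasoning

  cauchy-upTo : ∀ x C → 0ℚ ≤ C →
    (∀ δ → 0ℚ < δ → CloseFrom x (C * δ)) → IsCauchy x
  cauchy-upTo x C 0≤C h δ 0<δ = let N , close = h η 0<η in N , λ m n N≤m N≤n → begin
    ∣ x m - x n ∣   ≤⟨ close m n N≤m N≤n ⟩
    C * η           ≤⟨ *-monoʳ (<⇒≤ 0<η) (p≤p+q {C} 0≤1) ⟩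
    C' * η          ≡⟨ *-assoc C' (1/ C') δ ⟨
    C' * 1/ C' * δ  ≡⟨ cong (_* δ) (*-inverseʳ C') ⟩
    1ℚ * δ          ≡⟨ *-identityˡ δ ⟩
    δ               ∎
    where
    C' = C + 1ℚ
    instance
      C'-pos : ℚ.Positive C'
      C'-pos = positive (<-≤-trans (positive⁻¹ 1ℚ) (p≤q+p 0≤C))
      C'-nz : ℚ.NonZero C'
      C'-nz = pos⇒nonZero C'
    η = 1/ C' * δ
    0<η : 0ℚ < η
    0<η = positive⁻¹ η ⦃ pos*pos⇒pos (1/ C') ⦃ 1/pos⇒pos C' ⦄ δ ⦃ positive 0<δ ⦄ ⦄

  Bounded : (ℕ → ℚ) → Set
  Bounded x = ∃ λ B → Eventually λ n → ∣ x n ∣ ≤ ι B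

  bounded : ∀ x → Bounded (seq x)
  bounded x with N , close ← cauchy x 1ℚ (positive⁻¹ 1ℚ)
            with B , ≤B ← archimedean (1ℚ + ∣ seq x N ∣) = B , N , λ n N≤n → begin
    ∣ seq x n ∣                          ≡⟨ cong ∣_∣ (S.solve 2 (λ a b → a S.:= (a S.:- b) S.:+ b) refl (seq x n) (seq x N)) ⟩
    ∣ (seq x n - seq x N) + seq x N ∣    ≤⟨ ∣p+q∣≤∣p∣+∣q∣ (seq x n - seq x N) (seq x N) ⟩
    ∣ seq x n - seq x N ∣ + ∣ seq x N ∣  ≤⟨ +-monoˡ-≤ ∣ seq x N ∣ (close n N N≤n ℕ.≤-refl) ⟩
    1ℚ + ∣ seq x N ∣                     ≤⟨ ≤B ⟩
    ι B                                  ∎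

  ⊔-ˡ : ∀ {a b n} → a ℕ.⊔ b ℕ.≤ n → a ℕ.≤ n
  ⊔-ˡ {a} {b} = ℕ.≤-trans (ℕ.m≤m⊔n a b)

  ⊔-ʳ : ∀ {a b n} → a ℕ.⊔ b ℕ.≤ n → b ℕ.≤ n
  ⊔-ʳ {a} {b} = ℕ.≤-trans (ℕ.m≤n⊔m a b)

  +-bound : ∀ x₁ x₂ y₁ y₂ δ → ∣ x₁ - x₂ ∣ ≤ δ → ∣ y₁ - y₂ ∣ ≤ δ → ∣ (x₁ + y₁) - (x₂ + y₂) ∣ ≤ 2ℚ * δ
  +-bound x₁ x₂ y₁ y₂ δ p q = begin
    ∣ (x₁ + y₁) - (x₂ + y₂) ∣
      ≡⟨ cong ∣_∣ (S.solve 4 (λ a b c d → (a S.:+ b) S.:- (c S.:+ d) S.:= (a S.:- c) S.:+ (b S.:- d)) refl x₁ y₁ x₂ y₂) ⟩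
    ∣ (x₁ - x₂) + (y₁ - y₂) ∣
      ≤⟨ ∣p+q∣≤∣p∣+∣q∣ (x₁ - x₂) (y₁ - y₂) ⟩
    ∣ x₁ - x₂ ∣ + ∣ y₁ - y₂ ∣
      ≤⟨ +-mono-≤ p q ⟩
    δ + δ
      ≡⟨ S.solve 1 (λ d → d S.:+ d S.:= S.con 2ℚ S.:* d) refl δ ⟩
    2ℚ * δ ∎

  *-bound : ∀ A B x₁ x₂ y₁ y₂ δ → ∣ x₁ ∣ ≤ ι A → ∣ y₂ ∣ ≤ ι B → ∣ x₁ - x₂ ∣ ≤ δ → ∣ y₁ - y₂ ∣ ≤ δ →
            ∣ x₁ * y₁ - x₂ * y₂ ∣ ≤ (ι A + ι B) * δ
  *-bound A B x₁ x₂ y₁ y₂ δ x≤A y≤B p q = begin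
    ∣ x₁ * y₁ - x₂ * y₂ ∣
      ≡⟨ cong ∣_∣ (S.solve 4 (λ a b c d → a S.:* b S.:- c S.:* d S.:= a S.:* (b S.:- d) S.:+ (a S.:- c) S.:* d) refl x₁ y₁ x₂ y₂) ⟩
    ∣ x₁ * (y₁ - y₂) + (x₁ - x₂) * y₂ ∣
      ≤⟨ ∣p+q∣≤∣p∣+∣q∣ (x₁ * (y₁ - y₂)) ((x₁ - x₂) * y₂) ⟩
    ∣ x₁ * (y₁ - y₂) ∣ + ∣ (x₁ - x₂) * y₂ ∣
      ≡⟨ cong₂ _+_ (∣p*q∣≡∣p∣*∣q∣ x₁ (y₁ - y₂)) (∣p*q∣≡∣p∣*∣q∣ (x₁ - x₂) y₂) ⟩
    ∣ x₁ ∣ * ∣ y₁ - y₂ ∣ + ∣ x₁ - x₂ ∣ * ∣ y₂ ∣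
      ≤⟨ +-mono-≤ (*-mono (0≤∣p∣ x₁) x≤A (0≤∣p∣ (y₁ - y₂)) q) (*-mono (0≤∣p∣ (x₁ - x₂)) p (0≤∣p∣ y₂) y≤B) ⟩
    ι A * δ + δ * ι B
      ≡⟨ S.solve 3 (λ a b d → a S.:* d S.:+ d S.:* b S.:= (a S.:+ b) S.:* d) refl (ι A) (ι B) δ ⟩
    (ι A + ι B) * δ ∎

  expConst : ℕ → ℚ
  expConst B = cap B + (const B + const B)

  exp-bound : ∀ B m n x₁ x₂ δ → ∣ x₁ ∣ ≤ ι B → ∣ x₂ ∣ ≤ ι B → ∣ x₁ - x₂ ∣ ≤ δ → u m ≤ δ → u n ≤ δ →
              ∣ compound m x₁ - compound n x₂ ∣ ≤ expConst B * δ
  exp-bound B m n x₁ x₂ δ x₁≤B x₂≤B p um un = begin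
    ∣ compound m x₁ - compound n x₂ ∣
      ≤⟨ ∣-∣-triangle (compound m x₁) (compound m x₂) (compound n x₂) ⟩
    ∣ compound m x₁ - compound m x₂ ∣ + ∣ compound m x₂ - compound n x₂ ∣
      ≤⟨ +-mono-≤
           (≤-trans (compound-lipschitz B m x₁≤B x₂≤B) (*-monoˡ (0≤cap B) p))
           (≤-trans (compound-cauchy B m n x₂≤B) (+-mono-≤ (*-monoˡ (0≤const B) um) (*-monoˡ (0≤const B) un))) ⟩
    cap B * δ + (const B * δ + const B * δ)
      ≡⟨ S.solve 3 (λ g c d → g S.:* d S.:+ (c S.:* d S.:+ c S.:* d) S.:= (g S.:+ (c S.:+ c)) S.:* d) refl (cap B) (const B) δ ⟩
    expConst B * δ ∎

  abstract
    const-cauchy : ∀ q → IsCauchy (λ _ → q)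
    const-cauchy q δ 0<δ = 0 , λ _ _ _ _ → ≤-trans (≤-reflexive (cong ∣_∣ (+-inverseʳ q))) (<⇒≤ 0<δ)

    +-cauchy : ∀ x y → IsCauchy (λ n → seq x n + seq y n)
    +-cauchy x y = cauchy-upTo (λ n → seq x n + seq y n) 2ℚ (nonNegative⁻¹ 2ℚ) λ δ 0<δ →
      close δ (cauchy x δ 0<δ) (cauchy y δ 0<δ)
      where
      close : ∀ δ → CloseFrom (seq x) δ → CloseFrom (seq y) δ → CloseFrom (λ n → seq x n + seq y n) (2ℚ * δ)
      close δ (N , p) (M , q) = N ℕ.⊔ M , λ m n ≤m ≤n →
        +-bound (seq x m) (seq x n) (seq y m) (seq y n) δ
          (p m n (⊔-ˡ ≤m) (⊔-ˡ ≤n)) (q m n (⊔-ʳ {N} ≤m) (⊔-ʳ {N} ≤n))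

    neg-cauchy : ∀ x → IsCauchy (λ n → - seq x n)
    neg-cauchy x δ 0<δ = close (cauchy x δ 0<δ)
      where
      close : CloseFrom (seq x) δ → CloseFrom (λ n → - seq x n) δ
      close (N , p) = N , λ m n ≤m ≤n → begin
        ∣ - seq x m - - seq x n ∣    ≡⟨ cong ∣_∣ (S.solve 2 (λ a b → (S.:- a) S.:- (S.:- b) S.:= b S.:- a) refl (seq x m) (seq x n)) ⟩
        ∣ seq x n - seq x m ∣        ≤⟨ p n m ≤n ≤m ⟩
        δ                            ∎

    *-cauchy : ∀ x y → IsCauchy (λ n → seq x n * seq y n)
    *-cauchy x y = go (bounded x) (bounded y)
      where
      go : Bounded (seq x) → Bounded (seq y) → IsCauchy (λ n → seq x n * seq y n)
      go (A , K , x≤A) (B , L , y≤B) =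
        cauchy-upTo (λ n → seq x n * seq y n) (ι A + ι B) (+-nonNeg (0≤ι A) (0≤ι B)) λ δ 0<δ →
        close δ (cauchy x δ 0<δ) (cauchy y δ 0<δ)
        where
        close : ∀ δ → CloseFrom (seq x) δ → CloseFrom (seq y) δ →
                CloseFrom (λ n → seq x n * seq y n) ((ι A + ι B) * δ)
        close δ (N , p) (M , q) = (K ℕ.⊔ L) ℕ.⊔ (N ℕ.⊔ M) , λ m n ≤m ≤n →
          *-bound A B (seq x m) (seq x n) (seq y m) (seq y n) δ
            (x≤A m (⊔-ˡ (⊔-ˡ ≤m))) (y≤B n (⊔-ʳ {K} (⊔-ˡ ≤n)))
            (p m n (⊔-ˡ (⊔-ʳ {K ℕ.⊔ L} ≤m)) (⊔-ˡ (⊔-ʳ {K ℕ.⊔ L} ≤n)))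
            (q m n (⊔-ʳ {N} (⊔-ʳ {K ℕ.⊔ L} ≤m)) (⊔-ʳ {N} (⊔-ʳ {K ℕ.⊔ L} ≤n)))

    exp-cauchy : ∀ x → IsCauchy (λ n → compound n (seq x n))
    exp-cauchy x = go (bounded x)
      where
      go : Bounded (seq x) → IsCauchy (λ n → compound n (seq x n))
      go (B , K , x≤B) =
        cauchy-upTo (λ n → compound n (seq x n)) (expConst B) (+-nonNeg (0≤cap B) (+-nonNeg (0≤const B) (0≤const B))) λ δ 0<δ →
        close δ (cauchy x δ 0<δ) (u-small δ 0<δ)
        where
        close : ∀ δ → CloseFrom (seq x) δ → (∃ λ N → ∀ n → N ℕ.≤ n → u n ≤ δ) →
                CloseFrom (λ n → compound n (seq x n)) (expConst B * δ)
        close δ (N , p) (M , q) = K ℕ.⊔ (N ℕ.⊔ M) , λ m n ≤m ≤n →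
          exp-bound B m n (seq x m) (seq x n) δ
            (x≤B m (⊔-ˡ ≤m)) (x≤B n (⊔-ˡ ≤n))
            (p m n (⊔-ˡ (⊔-ʳ {K} ≤m)) (⊔-ˡ (⊔-ʳ {K} ≤n)))
            (q m (⊔-ʳ {N} (⊔-ʳ {K} ≤m))) (q n (⊔-ʳ {N} (⊔-ʳ {K} ≤n)))

open CauchyLemmas

fromℚ : ℚ → ℝ
fromℚ q = mkℝ (λ _ → q) (const-cauchy q)

fromℕ : ℕ → ℝ
fromℕ n = fromℚ (ι n)

0ℝ 1ℝ : ℝ
0ℝ = fromℚ 0ℚ
1ℝ = fromℚ 1ℚ

infix  8 -ℝ_
infixl 7 _*ℝ_
infixl 6 _+ℝ_

_+ℝ_ _*ℝ_ : ℝ → ℝ → ℝ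
x +ℝ y = mkℝ (λ n → seq x n + seq y n) (+-cauchy x y)
x *ℝ y = mkℝ (λ n → seq x n * seq y n) (*-cauchy x y)

-ℝ_ : ℝ → ℝ
-ℝ x = mkℝ (λ n → - seq x n) (neg-cauchy x)

-- eˣ as the limit of (1 + x/N)ᴺ, with N = n + 1.
exp : ℝ → ℝ
exp x = mkℝ (λ n → compound n (seq x n)) (exp-cauchy x)

-- A finitely supported distribution, as a list of weighted outcomes in which
-- an outcome may occur repeatedly.  Every distribution on permutations of a
-- finite set arises in this way.
record Distribution (A : Set) : Set where
  field
    outcomes : List (A × ℝ)
    nonneg   : All (λ (_ , w) → 0ℝ ≤ℝ w) outcomes
    total    : foldr (λ (_ , w) s → w +ℝ s) 0ℝ outcomes ≈ℝ 1ℝ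

open Distribution public

Pr : {A : Set} → Distribution A → (A → Bool) → ℝ
Pr D P = foldr (λ (a , w) s → (if P a then w else 0ℝ) +ℝ s) 0ℝ (outcomes D)

𝔼 : {A : Set} → Distribution A → (A → ℕ) → ℝ
𝔼 D f = foldr (λ (a , w) s → w *ℝ fromℕ (f a) +ℝ s) 0ℝ (outcomes D)

subsets : ∀ n → List (Subset n)
subsets zero    = [] ∷ []
subsets (suc n) = map (outside ∷_) (subsets n) ++ map (inside ∷_) (subsets n)

-- Hyperedges are nonempty: otherwise there would be no hitting set, and the
-- earliest vertex of an edge would be undefined.
record Hypergraph (d n : ℕ) : Set where
  field
    isEdge        : Subset n → Bool
    edge-nonempty : ∀ e → T (isEdge e) → Nonempty e
    edge-size≤d   : ∀ e → T (isEdge e) → size e ℕ.≤ d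

open Hypergraph public

module _ {d n : ℕ} where

  edges : Hypergraph d n → List (Subset n)
  edges G = filterᵇ (isEdge G) (subsets n)

  _△_ : Hypergraph d n → Hypergraph d n → List (Subset n)
  G △ G′ = filterᵇ (λ e → isEdge G e xor isEdge G′ e) (subsets n)

  Neighbours : Hypergraph d n → Hypergraph d n → Set
  Neighbours G G′ = length (G △ G′) ℕ.≤ 1

  IsHittingSet : Hypergraph d n → Subset n → Set
  IsHittingSet G S = All (λ e → Nonempty (S ∩ e)) (edges G)

  isHittingSet? : ∀ G → Decidable (IsHittingSet G)
  isHittingSet? G S = all? (λ e → nonempty? (S ∩ e)) (edges G)

  -- The default value n is attained, by the hitting set of all vertices.
  opt : Hypergraph d n → ℕ
  opt G = min n (map size (filter (isHittingSet? G) (subsets n)))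

-- π orders the vertices by their positions π ⟨$⟩ʳ v.
IsEarliest : ∀ {n} → Permutation′ n → Subset n → Fin n → Set
IsEarliest π e v = v ∈ e × (∀ w → w ∈ e → (π ⟨$⟩ʳ v) Fin.≤ (π ⟨$⟩ʳ w))

isEarliest? : ∀ {n} (π : Permutation′ n) e v → Dec (IsEarliest π e v)
isEarliest? π e v =
  (v ∈? e) ×-dec Fin.all? (λ w → (w ∈? e) →-dec ((π ⟨$⟩ʳ v) Fin.≤? (π ⟨$⟩ʳ w)))

decode : ∀ {d n} → Hypergraph d n → Permutation′ n → Subset n
decode G π = Vec.tabulate λ v → does (any? (λ e → isEarliest? π e v) (edges G))

Mechanism : ℕ → Set
Mechanism d = ∀ n → Hypergraph d n → Distribution (Permutation′ n)

-- Permutations are bijections with explicit inverses, compared pointwise by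
-- _≈_, so a set of outcomes has to respect _≈_.
IsDP : ∀ {d} → ℝ → Mechanism d → Set
IsDP {d} ε M = ∀ n (G G′ : Hypergraph d n) → Neighbours G G′ →
  (P : Permutation′ n → Bool) → P Preserves _≈_ ⟶ _≡_ →
  Pr (M n G) P ≤ℝ exp ε *ℝ Pr (M n G′) P

Encoder : ℕ → Set
Encoder d = (k : ℕ) → Mechanism d

IsApproximation : ∀ {d} → ℝ → Encoder d → Set
IsApproximation {d} α ℰ = ∀ n (G : Hypergraph d n) k → opt G ℕ.≤ k →
  𝔼 (ℰ k n G) (λ π → size (decode G π)) ≤ℝ α *ℝ fromℕ k

{-# OPTIONS --safe #-}

-- Take three vertices 0, 1, 2 and k = 1, and let G₀, G₁, G₂ have the edge sets
-- {01}, {01, 02} and {01, 12}.  All three have optimum 1.  A permutation that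
-- puts 1 before 0 costs two vertices on G₁, one that puts 0 before 1 costs two
-- on G₂, and by privacy the probabilities of these events on G₁ and G₂ are at
-- least e^{-ε} times those on G₀, which add up to 1.  Hence 2α ≥ 2 + e^{-ε}.
module Submission where

open import Defs
open import Data.Nat.Base using (_≤_)
open import Data.Product.Base using (∃; _×_)

open import Algebra.Bundles using (CommutativeRing)
open import Data.Bool.Base using (Bool; true; false; not; if_then_else_)
import Data.Bool.Properties as Bool
open import Data.Fin.Base as Fin using (Fin)
open import Data.Fin.Patterns using (0F; 1F; 2F)
open import Data.Fin.Permutation using (Permutation′; _⟨$⟩ʳ_; _≈_)
import Data.Fin.Properties as Fin
open import Data.Fin.Subset using (Subset; _∈_; _∪_; ⁅_⁆) renaming (∣_∣ to size)
open import Data.Fin.Subset.Properties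
  using (x∈⁅x⁆; x∈⁅y⁆⇒x≡y; x∈p∪q⁻; x∈p∪q⁺; x∈p∧x≢y⇒x∈p-y; x∈p⇒∣p-x∣<∣p∣; nonempty?)
open import Data.List.Base using (List; []; _∷_; foldr)
open import Data.List.Membership.Propositional using (lose) renaming (_∈_ to _∈ˡ_)
open import Data.List.Relation.Unary.All using (All; []; _∷_; all?; lookup)
open import Data.List.Relation.Unary.Any using (here; there; any?)
open import Data.Nat.Base as ℕ using (ℕ; suc; z≤n; s≤s)
import Data.Nat.Properties as ℕ
open import Data.Product.Base using (_,_; proj₁; proj₂)
open import Data.Rational.Base as ℚ using (ℚ; 0ℚ; 1ℚ; ½; ∣_∣)
import Data.Rational.Properties as ℚ
open import Data.Rational.Solver using () renaming (module +-*-Solver to S)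
open import Data.Sum.Base using (inj₁; inj₂; [_,_]′)
import Data.Vec.Properties as Vec
open import Relation.Binary.Bundles using (Preorder)
open import Relation.Binary.Core using (_Preserves_⟶_)
open import Relation.Binary.PropositionalEquality
import Relation.Binary.Reasoning.Preorder as PreorderReasoning
open import Relation.Nullary.Negation using (¬_)
open import Relation.Nullary.Decidable
  using (Dec; ¬?; does; yes; no; ⌊_⌋; True; toWitness; dec-true; _×-dec_)
open CommutativeRing ℚ.+-*-commutativeRing using (commutativeSemiring; semiring)
open import Algebra.Properties.Semiring.Exp semiring using (_^_)
open import Algebra.Properties.CommutativeSemiring.Exp commutativeSemiring using (^-distrib-*)

open RationalLemmas
open CauchyLemmas using (Bounded; bounded; ⊔-ˡ; ⊔-ʳ)

-- Order on the reals

zipEventually : {P Q R : ℕ → Set} → (∀ n → P n → Q n → R n) →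
                Eventually P → Eventually Q → Eventually R
zipEventually f (M , p) (N , q) = M ℕ.⊔ N , λ n ≤n → f n (p n (⊔-ˡ ≤n)) (q n (⊔-ʳ {M} ≤n))

mapEventually : {P Q : ℕ → Set} → (∀ n → P n → Q n) → Eventually P → Eventually Q
mapEventually f (M , p) = M , λ n ≤n → f n (p n ≤n)

infix 4 _≗ℝ_

-- Equality at every index, finer than `_≈ℝ_`. The operations act termwise, so ring identities over
-- ℚ hold in this sense and the solver proves them; they supply the `≈⟨ ⟩` steps of the reasoning
-- below.
_≗ℝ_ : ℝ → ℝ → Set
x ≗ℝ y = ∀ n → seq x n ≡ seq y n

½+½ : ∀ p → ½ ℚ.* p ℚ.+ ½ ℚ.* p ≡ p
½+½ = S.solve 1 (λ p → S.con ½ S.:* p S.:+ S.con ½ S.:* p S.:= p) refl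

half-pos : ∀ {δ} → 0ℚ ℚ.< δ → 0ℚ ℚ.< ½ ℚ.* δ
half-pos {δ} 0<δ = ℚ.positive⁻¹ (½ ℚ.* δ) ⦃ ℚ.pos*pos⇒pos ½ δ ⦃ ℚ.positive 0<δ ⦄ ⦄

pointwise-≤ : ∀ x y → (∀ n → seq x n ℚ.≤ seq y n) → x ≤ℝ y
pointwise-≤ x y x≤y δ 0<δ = 0 , λ n _ → ℚ.≤-trans (x≤y n) (p≤p+q (ℚ.<⇒≤ 0<δ))

≗⇒≤ : ∀ x y → x ≗ℝ y → x ≤ℝ y
≗⇒≤ x y x≗y = pointwise-≤ x y λ n → ℚ.≤-reflexive (x≗y n)

≤ℝ-trans : ∀ x y z → x ≤ℝ y → y ≤ℝ z → x ≤ℝ z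
≤ℝ-trans x y z x≤y y≤z δ 0<δ = zipEventually step (x≤y η 0<η) (y≤z η 0<η)
  where
  open ℚ.≤-Reasoning
  η = ½ ℚ.* δ
  0<η = half-pos 0<δ
  step : ∀ n → seq x n ℚ.≤ seq y n ℚ.+ η → seq y n ℚ.≤ seq z n ℚ.+ η → seq x n ℚ.≤ seq z n ℚ.+ δ
  step n p q = begin
    seq x n                 ≤⟨ p ⟩
    seq y n ℚ.+ η           ≤⟨ ℚ.+-monoˡ-≤ η q ⟩
    seq z n ℚ.+ η ℚ.+ η     ≡⟨ ℚ.+-assoc (seq z n) η η ⟩
    seq z n ℚ.+ (η ℚ.+ η)   ≡⟨ cong (seq z n ℚ.+_) (½+½ δ) ⟩
    seq z n ℚ.+ δ           ∎

≤ℝ-preorder : Preorder _ _ _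
≤ℝ-preorder = record
  { _≈_ = _≗ℝ_
  ; _≲_ = _≤ℝ_
  ; isPreorder = record
    { isEquivalence = record
      { refl  = λ _ → refl
      ; sym   = λ p n → sym (p n)
      ; trans = λ p q n → trans (p n) (q n)
      }
    ; reflexive = λ {x} {y} → ≗⇒≤ x y
    ; trans = λ {x} {y} {z} → ≤ℝ-trans x y z
    }
  }

open PreorderReasoning ≤ℝ-preorder

-- Applied to `total`, this makes the weights of a distribution add up to at least `1ℝ`.
≈ℝ⇒≥ : ∀ x y → x ≈ℝ y → y ≤ℝ x
≈ℝ⇒≥ x y x≈y δ 0<δ = mapEventually step (x≈y δ 0<δ)
  where
  module R = ℚ.≤-Reasoning
  step : ∀ n → ∣ seq x n ℚ.- seq y n ∣ ℚ.≤ δ → seq y n ℚ.≤ seq x n ℚ.+ δ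
  step n close = R.begin
    seq y n                                 R.≡⟨ S.solve 2 (λ a b → b S.:= a S.:+ (b S.:- a)) refl (seq x n) (seq y n) ⟩
    seq x n ℚ.+ (seq y n ℚ.- seq x n)       R.≤⟨ ℚ.+-monoʳ-≤ (seq x n) (p≤∣p∣ (seq y n ℚ.- seq x n)) ⟩
    seq x n ℚ.+ ∣ seq y n ℚ.- seq x n ∣     R.≡⟨ cong (seq x n ℚ.+_) (∣-∣-sym (seq y n) (seq x n)) ⟩
    seq x n ℚ.+ ∣ seq x n ℚ.- seq y n ∣     R.≤⟨ ℚ.+-monoʳ-≤ (seq x n) close ⟩
    seq x n ℚ.+ δ                           R.∎
    where
    p≤∣p∣ : ∀ p → p ℚ.≤ ∣ p ∣
    p≤∣p∣ p with ℚ.≤-total 0ℚ p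
    ... | inj₁ 0≤p = ℚ.≤-reflexive (sym (ℚ.0≤p⇒∣p∣≡p 0≤p))
    ... | inj₂ p≤0 = ℚ.≤-trans p≤0 (ℚ.0≤∣p∣ p)

+ℝ-mono-≤ : ∀ x y z w → x ≤ℝ y → z ≤ℝ w → x +ℝ z ≤ℝ y +ℝ w
+ℝ-mono-≤ x y z w x≤y z≤w δ 0<δ = zipEventually step (x≤y η 0<η) (z≤w η 0<η)
  where
  module R = ℚ.≤-Reasoning
  η = ½ ℚ.* δ
  0<η = half-pos 0<δ
  step : ∀ n → seq x n ℚ.≤ seq y n ℚ.+ η → seq z n ℚ.≤ seq w n ℚ.+ η →
         seq x n ℚ.+ seq z n ℚ.≤ seq y n ℚ.+ seq w n ℚ.+ δ
  step n p q = R.begin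
    seq x n ℚ.+ seq z n                       R.≤⟨ ℚ.+-mono-≤ p q ⟩
    seq y n ℚ.+ η ℚ.+ (seq w n ℚ.+ η)         R.≡⟨ S.solve 3 (λ a b d → a S.:+ d S.:+ (b S.:+ d) S.:= a S.:+ b S.:+ (d S.:+ d)) refl (seq y n) (seq w n) η ⟩
    seq y n ℚ.+ seq w n ℚ.+ (η ℚ.+ η)         R.≡⟨ cong (seq y n ℚ.+ seq w n ℚ.+_) (½+½ δ) ⟩
    seq y n ℚ.+ seq w n ℚ.+ δ                 R.∎

x≤x+y : ∀ x y → 0ℝ ≤ℝ y → x ≤ℝ x +ℝ y
x≤x+y x y 0≤y = begin
  x          ≈⟨ (λ n → sym (ℚ.+-identityʳ (seq x n))) ⟩
  x +ℝ 0ℝ    ≲⟨ +ℝ-mono-≤ x x 0ℝ y (≗⇒≤ x x λ _ → refl) 0≤y ⟩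
  x +ℝ y     ∎

-- The slack `δ + δ` is requested so that halving leaves `δ`. The final estimate adds one bound for
-- each of two hypergraphs and so arrives at twice the claim.
double-cancel-≤ : ∀ x y → x +ℝ x ≤ℝ y +ℝ y → x ≤ℝ y
double-cancel-≤ x y 2x≤2y δ 0<δ = mapEventually step (2x≤2y (δ ℚ.+ δ) (ℚ.+-mono-< 0<δ 0<δ))
  where
  module R = ℚ.≤-Reasoning
  step : ∀ n → seq x n ℚ.+ seq x n ℚ.≤ seq y n ℚ.+ seq y n ℚ.+ (δ ℚ.+ δ) → seq x n ℚ.≤ seq y n ℚ.+ δ
  step n p = R.begin
    seq x n                                                R.≡⟨ S.solve 1 (λ a → a S.:= S.con ½ S.:* (a S.:+ a)) refl (seq x n) ⟩
    ½ ℚ.* (seq x n ℚ.+ seq x n)                            R.≤⟨ *-monoˡ (ℚ.nonNegative⁻¹ ½) p ⟩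
    ½ ℚ.* (seq y n ℚ.+ seq y n ℚ.+ (δ ℚ.+ δ))              R.≡⟨ S.solve 2 (λ b d → S.con ½ S.:* (b S.:+ b S.:+ (d S.:+ d)) S.:= b S.:+ d) refl (seq y n) δ ⟩
    seq y n ℚ.+ δ                                          R.∎

-- Induction on `k` by repeated addition of `x`, so that no slack has to be rescaled.
*-fromℕ-nonneg : ∀ x k → 0ℝ ≤ℝ x → 0ℝ ≤ℝ x *ℝ fromℕ k
*-fromℕ-nonneg x ℕ.zero  0≤x = ≗⇒≤ 0ℝ (x *ℝ fromℕ 0) λ n → sym (ℚ.*-zeroʳ (seq x n))
*-fromℕ-nonneg x (suc k) 0≤x = begin
  0ℝ                   ≲⟨ 0≤x ⟩
  x                    ≲⟨ x≤x+y x (x *ℝ fromℕ k) (*-fromℕ-nonneg x k 0≤x) ⟩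
  x +ℝ x *ℝ fromℕ k    ≈⟨ (λ n → trans
                            (S.solve 2 (λ a c → a S.:+ a S.:* c S.:= a S.:* (S.con 1ℚ S.:+ c)) refl (seq x n) (ι k))
                            (cong (seq x n ℚ.*_) (sym (ι-suc k)))) ⟩
  x *ℝ fromℕ (suc k)   ∎

*-fromℕ-mono : ∀ x {m n} → 0ℝ ≤ℝ x → m ≤ n → x *ℝ fromℕ m ≤ℝ x *ℝ fromℕ n
*-fromℕ-mono x {m} 0≤x m≤n with k , refl ← ℕ.m≤n⇒∃[o]m+o≡n m≤n = begin
  x *ℝ fromℕ m                     ≲⟨ x≤x+y (x *ℝ fromℕ m) (x *ℝ fromℕ k) (*-fromℕ-nonneg x k 0≤x) ⟩
  x *ℝ fromℕ m +ℝ x *ℝ fromℕ k     ≈⟨ (λ i → trans (sym (ℚ.*-distribˡ-+ (seq x i) (ι m) (ι k)))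
                                                    (cong (seq x i ℚ.*_) (sym (ι-+ m k)))) ⟩
  x *ℝ fromℕ (m ℕ.+ k)             ∎

-- Factors between 0 and 1

InUnit : ℚ → Set
InUnit p = 0ℚ ℚ.≤ p × p ℚ.≤ 1ℚ

InUnit-^ : ∀ k {p} → InUnit p → InUnit (p ^ k)
InUnit-^ k (0≤p , p≤1) = ^-nonNeg k 0≤p , ^≤1 k 0≤p p≤1

1-InUnit : ∀ {p} → InUnit p → InUnit (1ℚ ℚ.- p)
1-InUnit {p} (0≤p , p≤1) =
  subst (ℚ._≤ 1ℚ ℚ.- p) (ℚ.+-inverseʳ p) (ℚ.+-monoˡ-≤ (ℚ.- p) p≤1) ,
  subst (1ℚ ℚ.- p ℚ.≤_) (ℚ.+-identityʳ 1ℚ) (ℚ.+-monoʳ-≤ 1ℚ (ℚ.neg-antimono-≤ 0≤p))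

InUnit-* : ∀ {p q} → InUnit p → InUnit q → InUnit (p ℚ.* q)
InUnit-* (0≤p , p≤1) (0≤q , q≤1) = *-nonNeg 0≤p 0≤q , *-mono 0≤p p≤1 0≤q q≤1

-- The eventual bound x ≤ 1 keeps the slack δ in y ≤ z + δ from growing.
*ℝ-mono-≤ : ∀ x y z → Eventually (λ n → InUnit (seq x n)) → y ≤ℝ z → x *ℝ y ≤ℝ x *ℝ z
*ℝ-mono-≤ x y z unit y≤z δ 0<δ = zipEventually step unit (y≤z δ 0<δ)
  where
  module R = ℚ.≤-Reasoning
  step : ∀ n → InUnit (seq x n) → seq y n ℚ.≤ seq z n ℚ.+ δ →
         seq x n ℚ.* seq y n ℚ.≤ seq x n ℚ.* seq z n ℚ.+ δ
  step n (0≤x , x≤1) p = R.begin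
    seq x n ℚ.* seq y n                          R.≤⟨ *-monoˡ 0≤x p ⟩
    seq x n ℚ.* (seq z n ℚ.+ δ)                  R.≡⟨ ℚ.*-distribˡ-+ (seq x n) (seq z n) δ ⟩
    seq x n ℚ.* seq z n ℚ.+ seq x n ℚ.* δ        R.≤⟨ ℚ.+-monoʳ-≤ (seq x n ℚ.* seq z n) (*-monoʳ (ℚ.<⇒≤ 0<δ) x≤1) ⟩
    seq x n ℚ.* seq z n ℚ.+ 1ℚ ℚ.* δ             R.≡⟨ cong (seq x n ℚ.* seq z n ℚ.+_) (ℚ.*-identityˡ δ) ⟩
    seq x n ℚ.* seq z n ℚ.+ δ                    R.∎

-- The difference of the two sides is `(1 - x) y`. Since `1 - x` lies in the unit interval along
-- with `x`, `*ℝ-mono-≤` shows that it is nonnegative.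
unit-*-≤ : ∀ x y → Eventually (λ n → InUnit (seq x n)) → 0ℝ ≤ℝ y → x *ℝ y ≤ℝ y
unit-*-≤ x y unit 0≤y = begin
  x *ℝ y                               ≲⟨ x≤x+y (x *ℝ y) (x′ *ℝ y) 0≤x′y ⟩
  x *ℝ y +ℝ x′ *ℝ y                    ≈⟨ (λ n → S.solve 2 (λ a b → a S.:* b S.:+ (S.con 1ℚ S.:- a) S.:* b S.:= b) refl (seq x n) (seq y n)) ⟩
  y                                    ∎
  where
  x′ = 1ℝ +ℝ -ℝ x
  0≤x′y = begin
    0ℝ           ≈⟨ (λ n → sym (ℚ.*-zeroʳ (seq x′ n))) ⟩
    x′ *ℝ 0ℝ     ≲⟨ *ℝ-mono-≤ x′ 0ℝ y (mapEventually (λ _ → 1-InUnit) unit) 0≤y ⟩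
    x′ *ℝ y      ∎

-- Finite stages of the exponential

*-u-InUnit : ∀ {p} B n → 0ℚ ℚ.≤ p → p ℚ.≤ ι B → B ≤ n → InUnit (p ℚ.* u n)
*-u-InUnit {p} B n 0≤p p≤B B≤n = *-nonNeg 0≤p (0≤u n) , (R.begin
  p ℚ.* u n            R.≤⟨ *-monoʳ (0≤u n) (ℚ.≤-trans p≤B (ι-mono {B} {suc n} (ℕ.m≤n⇒m≤1+n B≤n))) ⟩
  ι (suc n) ℚ.* u n    R.≡⟨ ι*u n ⟩
  1ℚ                   R.∎)
  where module R = ℚ.≤-Reasoning

-- Strict positivity makes the terms nonnegative from some index on, and a bound `B` on them is at
-- most `suc n` once `B ≤ n`.
exponent-InUnit : ∀ x → 0ℝ <ℝ x → Eventually λ n → InUnit (seq x n ℚ.* u n)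
exponent-InUnit x (δ , 0<δ , N , δ≤x) = go (bounded x)
  where
  go : Bounded (seq x) → Eventually λ n → InUnit (seq x n ℚ.* u n)
  go (B , M , x≤B) = B ℕ.⊔ (M ℕ.⊔ N) , λ n ≤n →
    let 0≤xn = ℚ.≤-trans (+-nonNeg ℚ.≤-refl (ℚ.<⇒≤ 0<δ)) (δ≤x n (⊔-ʳ {M} (⊔-ʳ {B} ≤n)))
    in *-u-InUnit B n 0≤xn
         (subst (ℚ._≤ ι B) (ℚ.0≤p⇒∣p∣≡p 0≤xn) (x≤B n (⊔-ˡ (⊔-ʳ {B} ≤n))))
         (⊔-ˡ ≤n)

compound-neg-InUnit : ∀ n p → InUnit (p ℚ.* u n) → InUnit (compound n (ℚ.- p))
compound-neg-InUnit n p unit = InUnit-^ (suc n) {1ℚ ℚ.+ (ℚ.- p) ℚ.* u n}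
  (subst InUnit (cong (1ℚ ℚ.+_) (ℚ.neg-distribˡ-* p (u n))) (1-InUnit unit))

-- With `t = p * u n` the product is `(1 - t * t) ^ suc n`. Thus `exp (-ℝ ε) *ℝ exp ε` is at most 1
-- already at all late finite stages, which is enough to invert the factor `exp ε` of the privacy
-- inequality.
compound-neg-*-InUnit : ∀ n p → InUnit (p ℚ.* u n) → InUnit (compound n (ℚ.- p) ℚ.* compound n p)
compound-neg-*-InUnit n p unit = subst InUnit
  (^-distrib-* (1ℚ ℚ.+ (ℚ.- p) ℚ.* u n) (1ℚ ℚ.+ p ℚ.* u n) (suc n))
  (InUnit-^ (suc n) {(1ℚ ℚ.+ (ℚ.- p) ℚ.* u n) ℚ.* (1ℚ ℚ.+ p ℚ.* u n)}
    (subst InUnit (difference-of-squares p (u n)) (1-InUnit (InUnit-* unit unit))))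
  where
  difference-of-squares : ∀ p v → 1ℚ ℚ.- (p ℚ.* v) ℚ.* (p ℚ.* v) ≡ (1ℚ ℚ.+ (ℚ.- p) ℚ.* v) ℚ.* (1ℚ ℚ.+ p ℚ.* v)
  difference-of-squares = S.solve 2 (λ p v → S.con 1ℚ S.:- (p S.:* v) S.:* (p S.:* v)
    S.:= (S.con 1ℚ S.:+ (S.:- p) S.:* v) S.:* (S.con 1ℚ S.:+ p S.:* v)) refl

exp-neg-InUnit : ∀ x → 0ℝ <ℝ x → Eventually λ n → InUnit (seq (exp (-ℝ x)) n)
exp-neg-InUnit x 0<x = mapEventually (λ n → compound-neg-InUnit n (seq x n)) (exponent-InUnit x 0<x)

exp-neg*exp-InUnit : ∀ x → 0ℝ <ℝ x → Eventually λ n → InUnit (seq (exp (-ℝ x) *ℝ exp x) n)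
exp-neg*exp-InUnit x 0<x = mapEventually (λ n → compound-neg-*-InUnit n (seq x n)) (exponent-InUnit x 0<x)

-- Finite distributions

module _ {A : Set} where

  Pr-nonneg : (D : Distribution A) (P : A → Bool) → 0ℝ ≤ℝ Pr D P
  Pr-nonneg D P = go (nonneg D)
    where
    sumIf : List (A × ℝ) → ℝ
    sumIf = foldr (λ (a , w) s → (if P a then w else 0ℝ) +ℝ s) 0ℝ
    go : ∀ {os} → All (λ (_ , w) → 0ℝ ≤ℝ w) os → 0ℝ ≤ℝ sumIf os
    go [] = ≗⇒≤ 0ℝ 0ℝ λ _ → refl
    go {(a , w) ∷ os} (0≤w ∷ 0≤ws) = +ℝ-mono-≤ 0ℝ (if P a then w else 0ℝ) 0ℝ (sumIf os) (0≤if (P a)) (go 0≤ws)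
      where
      0≤if : ∀ b → 0ℝ ≤ℝ (if b then w else 0ℝ)
      0≤if true  = 0≤w
      0≤if false = ≗⇒≤ 0ℝ 0ℝ λ _ → refl

  -- Each weight goes to exactly one of the two sums, and by `total` the weights add up to 1.
  Pr-complement : (D : Distribution A) (P : A → Bool) → 1ℝ ≤ℝ Pr D P +ℝ Pr D (λ a → not (P a))
  Pr-complement D P = begin
    1ℝ                                     ≲⟨ ≈ℝ⇒≥ (sumʷ (outcomes D)) 1ℝ (total D) ⟩
    sumʷ (outcomes D)                      ≈⟨ go (outcomes D) ⟩
    Pr D P +ℝ Pr D (λ a → not (P a))       ∎
    where
    sumʷ = foldr (λ ((_ , w) : A × ℝ) s → w +ℝ s) 0ℝ
    sumIf : (A → Bool) → List (A × ℝ) → ℝ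
    sumIf Q = foldr (λ (a , w) s → (if Q a then w else 0ℝ) +ℝ s) 0ℝ
    go : ∀ os → sumʷ os ≗ℝ sumIf P os +ℝ sumIf (λ a → not (P a)) os
    go [] n = refl
    go ((a , w) ∷ os) n rewrite go os n with P a
    ... | true  = S.solve 3 (λ w p q → w S.:+ (p S.:+ q) S.:= w S.:+ p S.:+ (S.con 0ℚ S.:+ q)) refl
                    (seq w n) (seq (sumIf P os) n) (seq (sumIf (λ a → not (P a)) os) n)
    ... | false = S.solve 3 (λ w p q → w S.:+ (p S.:+ q) S.:= S.con 0ℚ S.:+ p S.:+ (w S.:+ q)) refl
                    (seq w n) (seq (sumIf P os) n) (seq (sumIf (λ a → not (P a)) os) n)

  -- The hypothesis puts `f` above 1 plus the indicator of `P`. In expectation the 1 becomes the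
  -- total weight and the indicator becomes `Pr D P`.
  1+Pr≤𝔼 : (D : Distribution A) (f : A → ℕ) (P : A → Bool) →
           (∀ a → (if P a then 2 else 1) ≤ f a) → 1ℝ +ℝ Pr D P ≤ℝ 𝔼 D f
  1+Pr≤𝔼 D f P bound = begin
    1ℝ +ℝ Pr D P                    ≲⟨ +ℝ-mono-≤ 1ℝ (sumʷ (outcomes D)) (Pr D P) (Pr D P)
                                         (≈ℝ⇒≥ (sumʷ (outcomes D)) 1ℝ (total D)) (≗⇒≤ (Pr D P) (Pr D P) λ _ → refl) ⟩
    sumʷ (outcomes D) +ℝ Pr D P     ≲⟨ go (nonneg D) ⟩
    𝔼 D f                           ∎
    where
    sumʷ = foldr (λ ((_ , w) : A × ℝ) s → w +ℝ s) 0ℝ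
    sumIf sumf : List (A × ℝ) → ℝ
    sumIf = foldr (λ (a , w) s → (if P a then w else 0ℝ) +ℝ s) 0ℝ
    sumf  = foldr (λ (a , w) s → w *ℝ fromℕ (f a) +ℝ s) 0ℝ
    term : ∀ b w → 0ℝ ≤ℝ w → ∀ {m} → (if b then 2 else 1) ≤ m →
           w +ℝ (if b then w else 0ℝ) ≤ℝ w *ℝ fromℕ m
    term true w 0≤w {m} 2≤m = begin
      w +ℝ w          ≈⟨ (λ n → S.solve 1 (λ a → a S.:+ a S.:= a S.:* S.con (ι 2)) refl (seq w n)) ⟩
      w *ℝ fromℕ 2    ≲⟨ *-fromℕ-mono w 0≤w 2≤m ⟩
      w *ℝ fromℕ m    ∎
    term false w 0≤w {m} 1≤m = begin
      w +ℝ 0ℝ         ≈⟨ (λ n → S.solve 1 (λ a → a S.:+ S.con 0ℚ S.:= a S.:* S.con 1ℚ) refl (seq w n)) ⟩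
      w *ℝ fromℕ 1    ≲⟨ *-fromℕ-mono w 0≤w 1≤m ⟩
      w *ℝ fromℕ m    ∎
    go : ∀ {os} → All (λ (_ , w) → 0ℝ ≤ℝ w) os → sumʷ os +ℝ sumIf os ≤ℝ sumf os
    go [] = ≗⇒≤ (0ℝ +ℝ 0ℝ) 0ℝ λ _ → refl
    go {(a , w) ∷ os} (0≤w ∷ 0≤ws) = begin
      w +ℝ sumʷ os +ℝ (v +ℝ sumIf os)     ≈⟨ (λ n → S.solve 4 (λ w s v t → w S.:+ s S.:+ (v S.:+ t) S.:= w S.:+ v S.:+ (s S.:+ t)) refl
                                                (seq w n) (seq (sumʷ os) n) (seq v n) (seq (sumIf os) n)) ⟩
      w +ℝ v +ℝ (sumʷ os +ℝ sumIf os)     ≲⟨ +ℝ-mono-≤ (w +ℝ v) (w *ℝ fromℕ (f a)) (sumʷ os +ℝ sumIf os) (sumf os)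
                                               (term (P a) w 0≤w (bound a)) (go 0≤ws) ⟩
      w *ℝ fromℕ (f a) +ℝ sumf os         ∎
      where v = if P a then w else 0ℝ

-- The hypergraphs

infix 4 _∈ˡ?_

_∈ˡ?_ : ∀ {n} (e : Subset n) (es : List (Subset n)) → _
e ∈ˡ? es = any? (Vec.≡-dec Bool._≟_ e) es

-- Edges of size at most 2 are admissible for every `d` with `2 ≤ d`, so the same three graphs serve
-- all `d`. For concrete lists the implicit check is solved by evaluation.
fromEdges : ∀ {d n} → 2 ≤ d → (es : List (Subset n)) →
            {True (all? (λ e → nonempty? e ×-dec (size e ℕ.≤? 2)) es)} → Hypergraph d n
fromEdges 2≤d es {valid} = record
  { isEdge        = λ e → ⌊ e ∈ˡ? es ⌋
  ; edge-nonempty = λ e e∈es → proj₁ (lookup (toWitness valid) (toWitness e∈es))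
  ; edge-size≤d   = λ e e∈es → ℕ.≤-trans (proj₂ (lookup (toWitness valid) (toWitness e∈es))) 2≤d
  }

-- Lower bounds on the size of decoded sets

1≤size : ∀ {n x} {p : Subset n} → x ∈ p → 1 ≤ size p
1≤size x∈p = ℕ.≤-trans (s≤s z≤n) (x∈p⇒∣p-x∣<∣p∣ x∈p)

-- Deleting `y` lowers the size strictly and still leaves `x`.
2≤size : ∀ {n x y} {p : Subset n} → x ≢ y → x ∈ p → y ∈ p → 2 ≤ size p
2≤size x≢y x∈p y∈p = ℕ.≤-trans (s≤s (1≤size (x∈p∧x≢y⇒x∈p-y x∈p x≢y))) (x∈p⇒∣p-x∣<∣p∣ y∈p)

pair : ∀ {n} → Fin n → Fin n → Subset n
pair x y = ⁅ x ⁆ ∪ ⁅ y ⁆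

module _ {n : ℕ} {π : Permutation′ n} where

  earliestˡ : ∀ {x y} → π ⟨$⟩ʳ x Fin.≤ π ⟨$⟩ʳ y → IsEarliest π (pair x y) x
  earliestˡ {x} {y} x≤y = x∈p∪q⁺ (inj₁ (x∈⁅x⁆ x)) , λ w w∈ →
    [ (λ p → Fin.≤-reflexive (cong (π ⟨$⟩ʳ_) (sym (x∈⁅y⁆⇒x≡y x p))))
    , (λ p → subst (λ z → π ⟨$⟩ʳ x Fin.≤ π ⟨$⟩ʳ z) (sym (x∈⁅y⁆⇒x≡y y p)) x≤y) ]′ (x∈p∪q⁻ ⁅ x ⁆ ⁅ y ⁆ w∈)

  earliestʳ : ∀ {x y} → π ⟨$⟩ʳ y Fin.≤ π ⟨$⟩ʳ x → IsEarliest π (pair x y) y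
  earliestʳ {x} {y} y≤x = x∈p∪q⁺ (inj₂ (x∈⁅x⁆ y)) , λ w w∈ →
    [ (λ p → subst (λ z → π ⟨$⟩ʳ y Fin.≤ π ⟨$⟩ʳ z) (sym (x∈⁅y⁆⇒x≡y x p)) y≤x)
    , (λ p → Fin.≤-reflexive (cong (π ⟨$⟩ʳ_) (sym (x∈⁅y⁆⇒x≡y y p)))) ]′ (x∈p∪q⁻ ⁅ x ⁆ ⁅ y ⁆ w∈)

  module _ {d : ℕ} (G : Hypergraph d n) where

    earliest∈decode : ∀ {e v} → e ∈ˡ edges G → IsEarliest π e v → v ∈ decode G π
    earliest∈decode {v = v} e∈G first = Vec.lookup⇒[]= v (decode G π)
      (trans (Vec.lookup∘tabulate _ v)
             (dec-true (any? (λ e → isEarliest? π e v) (edges G)) (lose e∈G first)))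

    module _ {a b c : Fin n} (ab∈G : pair a b ∈ˡ edges G) where

      1≤decode : 1 ≤ size (decode G π)
      1≤decode with Fin.≤-total (π ⟨$⟩ʳ a) (π ⟨$⟩ʳ b)
      ... | inj₁ a≤b = 1≤size (earliest∈decode ab∈G (earliestˡ a≤b))
      ... | inj₂ b≤a = 1≤size (earliest∈decode ab∈G (earliestʳ b≤a))

      -- The edge `ab` contributes `b`, while `ac` contributes `a` or `c`, neither of which is `b`.
      2≤decode : pair a c ∈ˡ edges G → a ≢ b → c ≢ b → π ⟨$⟩ʳ b Fin.≤ π ⟨$⟩ʳ a →
                 2 ≤ size (decode G π)
      2≤decode ac∈G a≢b c≢b b≤a with Fin.≤-total (π ⟨$⟩ʳ a) (π ⟨$⟩ʳ c)
      ... | inj₁ a≤c = 2≤size a≢b (earliest∈decode ac∈G (earliestˡ a≤c)) (earliest∈decode ab∈G (earliestʳ b≤a))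
      ... | inj₂ c≤a = 2≤size c≢b (earliest∈decode ac∈G (earliestʳ c≤a)) (earliest∈decode ab∈G (earliestʳ b≤a))

-- Splitting on a generic decision lets `does A?` reduce without abstracting a concrete comparison
-- of positions out of the goal.
if-elim : ∀ {A B : Set} (A? : Dec A) (Q : B → Set) {x y} →
          (A → Q x) → (¬ A → Q y) → Q (if does A? then x else y)
if-elim (yes a) Q f g = f a
if-elim (no ¬a) Q f g = g ¬a

-- The lower bound on the ratio

theorem32 : ∃ λ c → 0ℝ <ℝ c ×
    (∀ d → 2 ≤ d → ∀ ε → 0ℝ <ℝ ε →
    ∀ (ℰ : Encoder d) → (∀ k → IsDP ε (ℰ k)) →
    ∀ α → 1ℝ ≤ℝ α → IsApproximation α ℰ →
    1ℝ +ℝ c *ℝ exp (-ℝ ε) ≤ℝ α)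
-- The constant ½ comes from halving `2 + x ≤ 2α`, where `x` is `exp (-ℝ ε)`.
theorem32 = fromℚ ½ , (½ , ℚ.positive⁻¹ ½ , 0 , λ _ _ → ℚ.≤-refl) , bound
  where
  bound : ∀ d → 2 ≤ d → ∀ ε → 0ℝ <ℝ ε →
    ∀ (ℰ : Encoder d) → (∀ k → IsDP ε (ℰ k)) →
    ∀ α → 1ℝ ≤ℝ α → IsApproximation α ℰ →
    1ℝ +ℝ fromℚ ½ *ℝ exp (-ℝ ε) ≤ℝ α
  bound d 2≤d ε 0<ε ℰ dp α _ approx = double-cancel-≤ (1ℝ +ℝ fromℚ ½ *ℝ x) α (begin
    1ℝ +ℝ fromℚ ½ *ℝ x +ℝ (1ℝ +ℝ fromℚ ½ *ℝ x)
      ≈⟨ (λ n → S.solve 1 (λ x → S.con 1ℚ S.:+ S.con ½ S.:* x S.:+ (S.con 1ℚ S.:+ S.con ½ S.:* x)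
                  S.:= S.con 1ℚ S.:+ S.con 1ℚ S.:+ x S.:* S.con 1ℚ) refl (seq x n)) ⟩
    -- The last `1ℝ` stands for the total probability on `G₀`, which is about to be split by the
    -- relative order of the vertices 0 and 1.
    1ℝ +ℝ 1ℝ +ℝ x *ℝ 1ℝ
      ≲⟨ +ℝ-mono-≤ 2ℝ 2ℝ (x *ℝ 1ℝ) (x *ℝ (p₀ +ℝ q₀)) (≗⇒≤ 2ℝ 2ℝ λ _ → refl)
           (*ℝ-mono-≤ x 1ℝ (p₀ +ℝ q₀) (exp-neg-InUnit ε 0<ε) (Pr-complement (M G₀) P)) ⟩
    1ℝ +ℝ 1ℝ +ℝ x *ℝ (p₀ +ℝ q₀)
      ≈⟨ (λ n → S.solve 3 (λ x p q → S.con 1ℚ S.:+ S.con 1ℚ S.:+ x S.:* (p S.:+ q)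
                  S.:= S.con 1ℚ S.:+ x S.:* p S.:+ (S.con 1ℚ S.:+ x S.:* q)) refl (seq x n) (seq p₀ n) (seq q₀ n)) ⟩
    1ℝ +ℝ x *ℝ p₀ +ℝ (1ℝ +ℝ x *ℝ q₀)
      ≲⟨ +ℝ-mono-≤ (1ℝ +ℝ x *ℝ p₀) α (1ℝ +ℝ x *ℝ q₀) α
           -- The symmetric difference with `G₀` has length 1 and the optimum is 1, both by
           -- evaluation, so `s≤s z≤n` proves each bound; likewise for `G₂`.
           (cost G₁ P (λ {π} {ρ} → P-resp {π} {ρ}) (s≤s z≤n) (s≤s z≤n) cost₁)
           (cost G₂ notP (λ {π} {ρ} π≈ρ → cong not (P-resp {π} {ρ} π≈ρ)) (s≤s z≤n) (s≤s z≤n) cost₂) ⟩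
    α +ℝ α ∎)
    where
    x = exp (-ℝ ε)
    2ℝ = 1ℝ +ℝ 1ℝ
    -- Privacy compares runs with the same parameter, and `1` is admissible for both `G₁` and `G₂`,
    -- where the cost is measured.
    M = ℰ 1 3
    G₀ = fromEdges 2≤d (pair 0F 1F ∷ [])
    G₁ = fromEdges 2≤d (pair 0F 1F ∷ pair 0F 2F ∷ [])
    -- `pair 1F 0F` evaluates to the same subset as `pair 0F 1F`; this order puts the vertex shared
    -- by the two edges first, as in `2≤decode`.
    G₂ = fromEdges 2≤d (pair 1F 0F ∷ pair 1F 2F ∷ [])
    P notP : Permutation′ 3 → Bool
    P π = does (π ⟨$⟩ʳ 1F Fin.<? π ⟨$⟩ʳ 0F)
    notP π = not (P π)
    p₀ = Pr (M G₀) P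
    q₀ = Pr (M G₀) notP
    P-resp : P Preserves _≈_ ⟶ _≡_
    P-resp π≈ρ = cong₂ (λ i j → does (i Fin.<? j)) (π≈ρ 1F) (π≈ρ 0F)
    cost : ∀ G Q → Q Preserves _≈_ ⟶ _≡_ → Neighbours G₀ G → opt G ≤ 1 →
           (∀ π → (if Q π then 2 else 1) ≤ size (decode G π)) → 1ℝ +ℝ x *ℝ Pr (M G₀) Q ≤ℝ α
    cost G Q Q-resp G₀∼G opt≤1 lower = begin
      1ℝ +ℝ x *ℝ q                        ≲⟨ +ℝ-mono-≤ 1ℝ 1ℝ (x *ℝ q) q′ (≗⇒≤ 1ℝ 1ℝ λ _ → refl) transfer ⟩
      1ℝ +ℝ q′                            ≲⟨ 1+Pr≤𝔼 (M G) (λ π → size (decode G π)) Q lower ⟩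
      𝔼 (M G) (λ π → size (decode G π))   ≲⟨ approx 3 G 1 opt≤1 ⟩
      α *ℝ 1ℝ                             ≈⟨ (λ n → ℚ.*-identityʳ (seq α n)) ⟩
      α                                   ∎
      where
      q = Pr (M G₀) Q
      q′ = Pr (M G) Q
      -- Privacy bounds `q` by `exp ε *ℝ q′`. Multiplying by `x` turns this into a lower bound on
      -- `q′`, because `x *ℝ exp ε` is eventually at most 1.
      transfer = begin
        x *ℝ q                ≲⟨ *ℝ-mono-≤ x q (exp ε *ℝ q′) (exp-neg-InUnit ε 0<ε) (dp 1 3 G₀ G G₀∼G Q Q-resp) ⟩
        x *ℝ (exp ε *ℝ q′)    ≈⟨ (λ n → sym (ℚ.*-assoc (seq x n) (seq (exp ε) n) (seq q′ n))) ⟩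
        x *ℝ exp ε *ℝ q′      ≲⟨ unit-*-≤ (x *ℝ exp ε) q′ (exp-neg*exp-InUnit ε 0<ε) (Pr-nonneg (M G) Q) ⟩
        q′                    ∎
    cost₁ : ∀ π → (if P π then 2 else 1) ≤ size (decode G₁ π)
    cost₁ π = if-elim (π ⟨$⟩ʳ 1F Fin.<? π ⟨$⟩ʳ 0F) (_≤ size (decode G₁ π))
      -- `subsets` lists the edge 02 before 01, so 01 is the second entry of `edges G₁`. In `G₂` the
      -- edge 12 likewise precedes 01.
      (λ 1<0 → 2≤decode {π = π} G₁ {0F} {1F} {2F} (there (here refl)) (here refl) (λ ()) (λ ()) (ℕ.<⇒≤ 1<0))
      (λ _   → 1≤decode {π = π} G₁ {0F} {1F} {2F} (there (here refl)))
    cost₂ : ∀ π → (if notP π then 2 else 1) ≤ size (decode G₂ π)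
    -- `notP π` is definitionally `does` of the negated decision, so `if-elim` applies to `¬?`
    -- directly.
    cost₂ π = if-elim (¬? (π ⟨$⟩ʳ 1F Fin.<? π ⟨$⟩ʳ 0F)) (_≤ size (decode G₂ π))
      (λ 1≮0 → 2≤decode {π = π} G₂ {1F} {0F} {2F} (there (here refl)) (here refl) (λ ()) (λ ()) (ℕ.≮⇒≥ 1≮0))
      (λ _   → 1≤decode {π = π} G₂ {1F} {0F} {2F} (there (here refl)))
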